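{- For every integer $n\ge 11$, $$\min\{f(P(n),M): M\in\mathcal{M}_2(P(n))\}=\left\lceil \frac{n}{12}\right\rceil+1 .$$
   Context: For $n\ge 3$, $P(n)=P(n,2)$ is the simple graph with vertex set $\{u_i,v_i:0\le i\le n-1\}$ and edge set $\{u_iu_{i+2},\,u_iv_i,\,v_iv_{i+1}:0\le i\le n-1\}$, subscripts modulo $n$. The edges $u_iv_i$ are called spokes. For a perfect matching $M$ of a graph $G$, a forcing set of $M$ is a subset $S\subseteq M$ contained in no perfect matching of $G$ other than $M$; the forcing number $f(G,M)$ is the minimum cardinality of a forcing set of $M$. $\mathcal{M}_2(P(n))$ is the set of perfect matchings $M$ of $P(n)$ such that either (i) $M$ contains at least one spoke, and for any two (cyclically) consecutive spokes $u_iv_i,u_jv_j$ of $M$ the number of spokes $u_kv_k$ of $P(n)$ strictly between them, $j-i-1$ (with $j$ taken as the representative in $(i,i+n]$), is $\equiv 2\pmod 4$ (if $M$ has exactly one spoke $u_iv_i$, it is regarded as two consecutive spokes with $j=i+n$, so the number is $n-1$); or (ii) $M$ contains no spoke, $4\mid n$, and for some $i$, $M=\bigcup_{k=0}^{n/4-1}\{u_{i+4k}u_{i+4k+2},\,u_{i+4k+1}u_{i+4k+3},\,v_{i+4k+1}v_{i+4k+2},\,v_{i+4k+3}v_{i+4k+4}\}$. -}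

module Defs where

open import Data.Bool using (Bool; T)
open import Data.Fin using (Fin; toℕ)
open import Data.Fin.Properties using (toℕ-injective; toℕ-fromℕ<)
open import Data.List using (List; length; filterᵇ; map; allFin; _++_)
open import Data.List.Membership.Propositional using () renaming (_∈_ to _∈ₗ_)
open import Data.List.Membership.Propositional.Properties
  using (∈-map⁺; ∈-map⁻; ∈-++⁺ˡ; ∈-++⁺ʳ; ∈-++⁻; ∈-allFin)
open import Data.List.Relation.Unary.Unique.Propositional using (Unique)
open import Data.List.Relation.Unary.Unique.Propositional.Properties
  using (map⁺; ++⁺; allFin⁺)
open import Data.Nat
open import Data.Nat.DivMod
open import Data.Nat.Divisibility using (_∣_)
open import Data.Nat.Properties
open import Data.Product using (_×_; _,_; ∃!; ∃-syntax; proj₁; proj₂; swap)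
open import Data.Sum using (_⊎_; inj₁; inj₂)
open import Function using (_⇔_; case_of_)
open import Relation.Binary.PropositionalEquality
open import Relation.Nullary using (¬_)

-- Graphs are given by an incidence map; `edges` enumerates the (finitely many)
-- edges without repetition.
record Graph : Set₁ where
  field
    V E            : Set
    ends           : E → V × V
    edges          : List E
    edges-complete : ∀ e → e ∈ₗ edges
    edges-unique   : Unique edges

-- Edges are unordered, so two edges are parallel also when their end pairs
-- agree up to a swap.
IsSimple : Graph → Set
IsSimple G =
    (∀ e → proj₁ (ends e) ≢ proj₂ (ends e))
  × (∀ e e′ → ends e ≡ ends e′ ⊎ ends e ≡ swap (ends e′) → e ≡ e′)
  where open Graph G

module _ (G : Graph) where
  open Graph G

  EdgeSet : Set
  EdgeSet = E → Bool

module _ {G : Graph} where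
  open Graph G

  infix 4 _∈_ _∉_ _⊆_

  _∈_ _∉_ : E → EdgeSet G → Set
  e ∈ S = T (S e)
  e ∉ S = ¬ e ∈ S

  _⊆_ : EdgeSet G → EdgeSet G → Set
  S ⊆ M = ∀ e → e ∈ S → e ∈ M

  size : EdgeSet G → ℕ
  size S = length (filterᵇ S edges)

  Incident : V → E → Set
  Incident x e = x ≡ proj₁ (ends e) ⊎ x ≡ proj₂ (ends e)

  IsPerfectMatching : EdgeSet G → Set
  IsPerfectMatching M = ∀ x → ∃! _≡_ λ e → e ∈ M × Incident x e

  -- M′ = M is extensional equality of edge sets.
  IsForcingSet : EdgeSet G → EdgeSet G → Set
  IsForcingSet M S =
    S ⊆ M × (∀ M′ → IsPerfectMatching M′ → S ⊆ M′ → ∀ e → e ∈ M′ ⇔ e ∈ M)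

IsMinimum : (ℕ → Set) → ℕ → Set
IsMinimum A m = A m × (∀ k → A k → m ≤ k)

-- f(G, M) = k
IsForcingNumber : (G : Graph) → EdgeSet G → ℕ → Set
IsForcingNumber G M =
  IsMinimum λ k → ∃[ S ] IsForcingSet {G} M S × size {G} S ≡ k

⌈_/_⌉ : (m d : ℕ) .{{_ : NonZero d}} → ℕ
⌈ m / d ⌉ = (m + pred d) / d

infixl 6 _⊕_

_⊕_ : ∀ {n} .{{_ : NonZero n}} → Fin n → ℕ → Fin n
_⊕_ {n} i k = (toℕ i + k) mod n

data Vertex (n : ℕ) : Set where
  u v : Fin n → Vertex n

data Edge (n : ℕ) : Set where
  uu uv vv : Fin n → Edge n

module _ {n : ℕ} where

  private
    uu-inj : ∀ {i j : Fin n} → uu i ≡ uu j → i ≡ j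
    uu-inj refl = refl

    uv-inj : ∀ {i j : Fin n} → uv i ≡ uv j → i ≡ j
    uv-inj refl = refl

    vv-inj : ∀ {i j : Fin n} → vv i ≡ vv j → i ≡ j
    vv-inj refl = refl

  allEdges : List (Edge n)
  allEdges = map uu (allFin n) ++ map uv (allFin n) ++ map vv (allFin n)

  allEdges-complete : ∀ e → e ∈ₗ allEdges
  allEdges-complete (uu i) = ∈-++⁺ˡ (∈-map⁺ uu (∈-allFin i))
  allEdges-complete (uv i) =
    ∈-++⁺ʳ (map uu (allFin n)) (∈-++⁺ˡ (∈-map⁺ uv (∈-allFin i)))
  allEdges-complete (vv i) =
    ∈-++⁺ʳ (map uu (allFin n)) (∈-++⁺ʳ (map uv (allFin n)) (∈-map⁺ vv (∈-allFin i)))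

  allEdges-unique : Unique allEdges
  allEdges-unique =
    ++⁺ (map⁺ uu-inj (allFin⁺ n))
        (++⁺ (map⁺ uv-inj (allFin⁺ n)) (map⁺ vv-inj (allFin⁺ n))
          λ (p , q) → case ∈-map⁻ uv p , ∈-map⁻ vv q of λ
            { ((_ , _ , refl) , (_ , _ , ())) })
        λ (p , q) → case ∈-map⁻ uu p , ∈-++⁻ (map uv (allFin n)) q of λ
          { ((_ , _ , refl) , inj₁ r) → case ∈-map⁻ uv r of λ { (_ , _ , ()) }
          ; ((_ , _ , refl) , inj₂ r) → case ∈-map⁻ vv r of λ { (_ , _ , ()) } }

incidence : ∀ {n} .{{_ : NonZero n}} → Edge n → Vertex n × Vertex n
incidence (uu i) = u i , u (i ⊕ 2)
incidence (uv i) = u i , v i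
incidence (vv i) = v i , v (i ⊕ 1)

-- For n = 4 the names uu i and uu (i ⊕ 2) denote the same edge of the simple
-- graph, and n ≤ 2 degenerates as well; P-simple below shows that for n ≥ 5
-- this is a simple graph.
P : (n : ℕ) .{{_ : NonZero n}} → Graph
P n = record
  { V              = Vertex n
  ; E              = Edge n
  ; ends           = incidence
  ; edges          = allEdges
  ; edges-complete = allEdges-complete
  ; edges-unique   = allEdges-unique
  }

module _ {n : ℕ} .{{_ : NonZero n}} where

  private
    toℕ-⊕ : ∀ (i : Fin n) k → toℕ (i ⊕ k) ≡ (toℕ i + k) % n
    toℕ-⊕ i k = toℕ-fromℕ< (m%n<n (toℕ i + k) n)

    ⊕-⊕ : ∀ (i : Fin n) a b → i ⊕ a ⊕ b ≡ i ⊕ (a + b)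
    ⊕-⊕ i a b = toℕ-injective (begin
      toℕ (i ⊕ a ⊕ b)                          ≡⟨ toℕ-⊕ (i ⊕ a) b ⟩
      (toℕ (i ⊕ a) + b) % n                    ≡⟨ cong (λ x → (x + b) % n) (toℕ-⊕ i a) ⟩
      ((toℕ i + a) % n + b) % n                ≡⟨ %-distribˡ-+ ((toℕ i + a) % n) b n ⟩
      ((toℕ i + a) % n % n + b % n) % n        ≡⟨ cong (λ x → (x + b % n) % n) (m%n%n≡m%n (toℕ i + a) n) ⟩
      ((toℕ i + a) % n + b % n) % n            ≡⟨ %-distribˡ-+ (toℕ i + a) b n ⟨
      (toℕ i + a + b) % n                      ≡⟨ cong (_% n) (+-assoc (toℕ i) a b) ⟩
      (toℕ i + (a + b)) % n                    ≡⟨ toℕ-⊕ i (a + b) ⟨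
      toℕ (i ⊕ (a + b))                        ∎)
      where open ≡-Reasoning

    ⊕-no-fix : ∀ (i : Fin n) k → k < n → k ≢ 0 → i ≢ i ⊕ k
    ⊕-no-fix i k k<n k≢0 eq = k≢0 (begin
      k          ≡⟨ m<n⇒m%n≡m k<n ⟨
      k % n      ≡⟨ cong (_% n) k≡qn ⟩
      q * n % n  ≡⟨ m*n%n≡0 q n ⟩
      0          ∎)
      where
      open ≡-Reasoning
      q = (toℕ i + k) / n
      k≡qn : k ≡ q * n
      k≡qn = +-cancelˡ-≡ (toℕ i) k (q * n) (begin
        toℕ i + k                    ≡⟨ m≡m%n+[m/n]*n (toℕ i + k) n ⟩
        (toℕ i + k) % n + q * n      ≡⟨ cong (_+ q * n) (trans (cong toℕ eq) (toℕ-⊕ i k)) ⟨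
        toℕ i + q * n                ∎)

    u-inj : ∀ {i j : Fin n} → u i ≡ u j → i ≡ j
    u-inj refl = refl

    v-inj : ∀ {i j : Fin n} → v i ≡ v j → i ≡ j
    v-inj refl = refl

  P-simple : 5 ≤ n → IsSimple (P n)
  P-simple 5≤n = loopless , noParallel
    where
    open Graph (P n)

    <n : ∀ {k} → k ≤ 4 → k < n
    <n k≤4 = ≤-trans (s≤s k≤4) 5≤n

    loopless : ∀ e → proj₁ (ends e) ≢ proj₂ (ends e)
    loopless (uu i) eq = ⊕-no-fix i 2 (<n (m≤m+n 2 2)) (λ ()) (u-inj eq)
    loopless (uv i) ()
    loopless (vv i) eq = ⊕-no-fix i 1 (<n (m≤m+n 1 3)) (λ ()) (v-inj eq)

    noSwap : ∀ (i j : Fin n) k → k + k ≤ 4 → k ≢ 0 → i ≡ j ⊕ k → ¬ i ⊕ k ≡ j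
    noSwap i j k 2k≤4 k≢0 refl eq =
      ⊕-no-fix j (k + k) (<n 2k≤4) (λ z → k≢0 (m+n≡0⇒m≡0 k z))
        (trans (sym eq) (⊕-⊕ j k k))

    noParallel : ∀ e e′ → ends e ≡ ends e′ ⊎ ends e ≡ swap (ends e′) → e ≡ e′
    noParallel (uu i) (uu j) (inj₁ eq) = cong uu (u-inj (cong proj₁ eq))
    noParallel (uu i) (uu j) (inj₂ eq) with () ←
      noSwap i j 2 ≤-refl (λ ()) (u-inj (cong proj₁ eq)) (u-inj (cong proj₂ eq))
    noParallel (uu i) (uv j) (inj₁ ())
    noParallel (uu i) (uv j) (inj₂ ())
    noParallel (uu i) (vv j) (inj₁ ())
    noParallel (uu i) (vv j) (inj₂ ())
    noParallel (uv i) (uu j) (inj₁ ())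
    noParallel (uv i) (uu j) (inj₂ ())
    noParallel (uv i) (uv j) (inj₁ eq) = cong uv (u-inj (cong proj₁ eq))
    noParallel (uv i) (uv j) (inj₂ ())
    noParallel (uv i) (vv j) (inj₁ ())
    noParallel (uv i) (vv j) (inj₂ ())
    noParallel (vv i) (uu j) (inj₁ ())
    noParallel (vv i) (uu j) (inj₂ ())
    noParallel (vv i) (uv j) (inj₁ ())
    noParallel (vv i) (uv j) (inj₂ ())
    noParallel (vv i) (vv j) (inj₁ eq) = cong vv (v-inj (cong proj₁ eq))
    noParallel (vv i) (vv j) (inj₂ eq) with () ←
      noSwap i j 1 (m≤m+n 2 2) (λ ()) (v-inj (cong proj₁ eq)) (v-inj (cong proj₂ eq))

module _ (n : ℕ) .{{_ : NonZero n}} where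

  private
    infix 4 _∈ᴾ_ _∉ᴾ_
    _∈ᴾ_ _∉ᴾ_ : Edge n → EdgeSet (P n) → Set
    _∈ᴾ_ = _∈_ {P n}
    _∉ᴾ_ = _∉_ {P n}

  -- Consecutive spokes are at i and j = i + g + 1 with g = j - i - 1 spokes of
  -- the graph strictly between them; g < n says j ∈ (i, i + n].  A single spoke
  -- of M is consecutive to itself, with g = n - 1.
  SpokeGaps≡2mod4 : EdgeSet (P n) → Set
  SpokeGaps≡2mod4 M =
    ∀ i g → g < n →
    uv i ∈ᴾ M → uv (i ⊕ suc g) ∈ᴾ M → (∀ k → k < g → uv (i ⊕ suc k) ∉ᴾ M) →
    g % 4 ≡ 2

  -- The four alternatives are u_{i+4k}u_{i+4k+2}, u_{i+4k+1}u_{i+4k+3},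
  -- v_{i+4k+1}v_{i+4k+2} and v_{i+4k+3}v_{i+4k+4}, named by their first ends.
  InBlock : Fin n → ℕ → Edge n → Set
  InBlock i k e =
      e ≡ uu (i ⊕ 4 * k)
    ⊎ e ≡ uu (i ⊕ (4 * k + 1))
    ⊎ e ≡ vv (i ⊕ (4 * k + 1))
    ⊎ e ≡ vv (i ⊕ (4 * k + 3))

  𝓜₂ : EdgeSet (P n) → Set
  𝓜₂ M = IsPerfectMatching {P n} M ×
    ( ((∃[ i ] uv i ∈ᴾ M) × SpokeGaps≡2mod4 M)
    ⊎ ((∀ i → uv i ∉ᴾ M) × 4 ∣ n ×
       (∃[ i ] ∀ e → e ∈ᴾ M ⇔ (∃[ k ] k < n / 4 × InBlock i k e))))

-- Cut the graph between consecutive indices. The edges of a perfect matching crossing a cut form one of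
-- eight states, which split by parity into two 4-cycles of phases; a spoke is a shortcut from phase p₀,
-- to p₂ in the odd cycle and back to p₀ in the even one. So perfect matchings are the cyclic tilings by
-- blocks of lengths 3 and 4 (odd) or 1 and 4 (even), each 3- or 1-block holding one spoke, and 𝓜₂
-- consists of the odd ones.
--
-- Upper bound. Two spokes at a distance of 3, 6, 7, 9, 11 or 12 determine an odd matching between them,
-- and each n ≥ 11 is a sum of ⌈n/12⌉ such distances. The only rivals left are even, and they are excluded
-- by one more edge, an outer edge spanning one of the spokes.
--
-- Lower bound. Follow M once around, starting just behind an edge e of a forcing set S, and record the
-- phases reachable by S-compatible walks that have left M, and those reachable by S-compatible even walks
-- from the at most two even states compatible with e. Since S is forcing, no stray walk rejoins M and no
-- even walk closes up. This bookkeeping is a finite automaton. A potential on its nodes that increases by at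
-- least 1 - 12 ∣S ∩ column∣ with every column bounds n - 12 ∣S∣ by its values around the last column, which
-- gives n ≤ 12 (∣S∣ - 1); it is found by relaxation and verified by evaluation.
module Submission where

open import Defs
open import Data.Bool using (Bool; true; false; T; not; _∧_; _∨_; _xor_; if_then_else_)
open import Data.Bool.ListAction using (all)
open import Data.Bool.Properties using (T?; T-∧; T-∨)
open import Data.Empty using (⊥; ⊥-elim)
open import Data.Fin using (Fin; toℕ; zero; suc)
open import Data.Fin.Properties using (any?; toℕ-injective; toℕ-fromℕ<; toℕ<n)
open import Data.List
  using (List; []; _∷_; _∷ʳ_; _++_; map; length; replicate; foldr; concatMap; filterᵇ; allFin; tabulate)
open import Data.List.Membership.Propositional using () renaming (_∈_ to _∈ₗ_)
open import Data.List.Membership.Propositional.Properties using (∈-concatMap⁺; ∈-map⁺)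
open import Data.List.Properties using (length-replicate; length-++; length-map; map-++; map-∘; map-tabulate)
open import Data.List.Relation.Unary.All as All using (All; []; _∷_)
open import Data.List.Relation.Unary.All.Properties using (all⁺) renaming (++⁺ to All-++⁺)
open import Data.List.Relation.Unary.Any as Any using (here; there)
open import Data.Nat
open import Data.Nat.Divisibility using (∣-refl)
open import Data.Nat.DivMod
open import Data.Nat.ListAction using (sum)
open import Data.Nat.ListAction.Properties using (sum-++)
open import Data.Nat.Properties
open import Data.Nat.Tactic.RingSolver using (solve-∀)
open import Data.Product using (_×_; _,_; proj₁; proj₂; ∃!; ∃-syntax; Σ-syntax)
open import Data.Sum using (_⊎_; inj₁; inj₂; [_,_]′)
open import Data.Unit using (⊤)
open import Data.Vec using (Vec; []; _∷_)
open import Function using (_∘_; id; case_of_; Equivalence; _⇔_; mk⇔)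
open import Relation.Binary.PropositionalEquality
open import Relation.Nullary using (¬_; yes; no)

-- Perfect matchings as walks: columns, states and steps.

-- Column k of an edge set is its part at uv k, uu k and vv k, in this order.
record Column : Set where
  constructor ⟨_,_,_⟩
  field spoke outer inner : Bool
open Column

-- The parity is that of the number of matching edges crossing the cut: one or three in the odd
-- states, none or two in the even ones.
data Parity : Set where odd even : Parity
data Phase : Set where p₀ p₁ p₂ p₃ : Phase

State : Set
State = Parity × Phase

rung : Column
rung = ⟨ true , false , false ⟩

-- The spokeless column that leads to a given state.
slide : Parity → Phase → Column
slide odd  p₀ = ⟨ false , true  , false ⟩
slide odd  p₁ = ⟨ false , true  , true  ⟩
slide odd  p₂ = ⟨ false , false , false ⟩
slide odd  p₃ = ⟨ false , false , true  ⟩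
slide even p₀ = ⟨ false , false , false ⟩
slide even p₁ = ⟨ false , true  , true  ⟩
slide even p₂ = ⟨ false , true  , false ⟩
slide even p₃ = ⟨ false , false , true  ⟩

landing : Parity → Phase
landing odd  = p₂
landing even = p₀

steps : State → List (Column × State)
steps (π , p₀) = (slide π p₁ , π , p₁) ∷ (rung , π , landing π) ∷ []
steps (π , p₁) = (slide π p₂ , π , p₂) ∷ []
steps (π , p₂) = (slide π p₃ , π , p₃) ∷ []
steps (π , p₃) = (slide π p₀ , π , p₀) ∷ []

infix 7 _⊑ᵇ_
_⊑ᵇ_ : Column → Column → Bool
⟨ s , o , i ⟩ ⊑ᵇ ⟨ s′ , o′ , i′ ⟩ = (not s ∨ s′) ∧ (not o ∨ o′) ∧ (not i ∨ i′)

bit : Bool → ℕ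
bit b = if b then 1 else 0

∣_∣ᶜ : Column → ℕ
∣ ⟨ s , o , i ⟩ ∣ᶜ = bit s + (bit o + bit i)

-- Sets of phases and nodes of the automaton.

data PhaseSet : Set where
  ⟦_,_,_,_⟧ : (a b c d : Bool) → PhaseSet

infix 7 _∋_
_∋_ : PhaseSet → Phase → Bool
⟦ a , b , c , d ⟧ ∋ p₀ = a
⟦ a , b , c , d ⟧ ∋ p₁ = b
⟦ a , b , c , d ⟧ ∋ p₂ = c
⟦ a , b , c , d ⟧ ∋ p₃ = d

phaseSet : (Phase → Bool) → PhaseSet
phaseSet f = ⟦ f p₀ , f p₁ , f p₂ , f p₃ ⟧

infix 7 _≡ᵖ_
_≡ᵖ_ : Phase → Phase → Bool
p₀ ≡ᵖ p₀ = true
p₁ ≡ᵖ p₁ = true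
p₂ ≡ᵖ p₂ = true
p₃ ≡ᵖ p₃ = true
_  ≡ᵖ _  = false

-- The relation `steps` read backwards: each component collects the predecessors of one phase whose
-- column contains the marks `t`.
image : Parity → Column → PhaseSet → PhaseSet
image odd t ⟦ a , b , c , d ⟧ =
  ⟦ d ∧ t ⊑ᵇ slide odd p₀ , a ∧ t ⊑ᵇ slide odd p₁
  , a ∧ t ⊑ᵇ rung ∨ b ∧ t ⊑ᵇ slide odd p₂ , c ∧ t ⊑ᵇ slide odd p₃ ⟧
image even t ⟦ a , b , c , d ⟧ =
  ⟦ a ∧ t ⊑ᵇ rung ∨ d ∧ t ⊑ᵇ slide even p₀ , a ∧ t ⊑ᵇ slide even p₁
  , b ∧ t ⊑ᵇ slide even p₂ , c ∧ t ⊑ᵇ slide even p₃ ⟧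

only : Phase → PhaseSet
only p = phaseSet (_≡ᵖ p)

add remove : Phase → PhaseSet → PhaseSet
add    p X = phaseSet λ q → p ≡ᵖ q ∨ X ∋ q
remove p X = phaseSet λ q → not (p ≡ᵖ q) ∧ X ∋ q

-- met: the walk has passed an edge of S since the start; strays: phases of odd walks that have left M;
-- evens₁, evens₂: phases of the even walks from the two even starting states.
record Node : Set where
  constructor node
  field
    met            : Bool
    phase          : Phase
    strays         : PhaseSet
    evens₁ evens₂  : PhaseSet
open Node

-- Tables indexed by nodes.

Key : Set
Key = Vec Bool 15

encode : Node → Key
encode (node m p ⟦ a , b , c , d ⟧ ⟦ e , f , g , h ⟧ ⟦ i , j , k , l ⟧) =
  m ∷ hi p ∷ lo p ∷ a ∷ b ∷ c ∷ d ∷ e ∷ f ∷ g ∷ h ∷ i ∷ j ∷ k ∷ l ∷ []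
  where
  hi lo : Phase → Bool
  hi p₀ = false
  hi p₁ = false
  hi p₂ = true
  hi p₃ = true
  lo p₀ = false
  lo p₁ = true
  lo p₂ = false
  lo p₃ = true

decode : Key → Node
decode (m ∷ x ∷ y ∷ a ∷ b ∷ c ∷ d ∷ e ∷ f ∷ g ∷ h ∷ i ∷ j ∷ k ∷ l ∷ []) =
  node m (if x then (if y then p₃ else p₂) else (if y then p₁ else p₀))
       ⟦ a , b , c , d ⟧ ⟦ e , f , g , h ⟧ ⟦ i , j , k , l ⟧

data Trie : ℕ → Set where
  none : ∀ {n} → Trie n
  leaf : ℕ → Trie 0
  fork : ∀ {n} → Trie n → Trie n → Trie (suc n)

lookup : ∀ {n} → Vec Bool n → Trie n → ℕ
lookup ks          none       = 0
lookup []          (leaf x)   = x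
lookup (false ∷ ks) (fork l r) = lookup ks l
lookup (true ∷ ks) (fork l r) = lookup ks r

insert : ∀ {n} → Vec Bool n → ℕ → Trie n → Trie n
insert []           x _          = leaf x
insert (false ∷ ks) x none       = fork (insert ks x none) none
insert (true ∷ ks)  x none       = fork none (insert ks x none)
insert (false ∷ ks) x (fork l r) = fork (insert ks x l) r
insert (true ∷ ks)  x (fork l r) = fork l (insert ks x r)

every : ∀ {n} → (Vec Bool n → ℕ → Bool) → Trie n → Bool
every P none       = true
every P (leaf x)   = P [] x
every P (fork l r) = every (P ∘ (false ∷_)) l ∧ every (P ∘ (true ∷_)) r

below : Bool → List Bool
below b = false ∷ (if b then true ∷ [] else [])

submarks : Column → List Column
submarks ⟨ s , o , i ⟩ =
  concatMap (λ x → concatMap (λ y → map (λ z → ⟨ x , y , z ⟩) (below i)) (below o)) (below s)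

-- Added to all potentials so that they stay positive: lookup returns 0 for an absent key.
offset : ℕ
offset = 100

-- A walk starts behind the edge `mark` of S. If `spokes?` is false, then S is known to contain no spoke;
-- without this knowledge the automaton is too weak for the starts in phase p₁.
record Start : Set where
  constructor start
  field
    spokes? : Bool
    mark    : Column
    phase₀  : Phase
    even₁ even₂ : Phase

-- The potential: search and verification.

module _ (ι : Start) where
  open Start ι

  allowed : Column → Column
  allowed ⟨ s , o , i ⟩ = ⟨ s ∧ spokes? , o , i ⟩

  -- A stray walk would rejoin M behind this column. A forcing set excludes this, so such columns
  -- carry no inequality.
  dead : Node → Phase → Column → Bool
  dead q p t = image odd t (strays q) ∋ p

  -- Strays continue earlier strays or leave M at this column. Removing `p′` discards the step of M
  -- itself and loses no stray, since a stray arriving there makes the column dead.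
  succ : Node → Phase → Column → Node
  succ (node m p R E₁ E₂) p′ t =
    node (m ∨ (0 <ᵇ ∣ t ∣ᶜ)) p′ (remove p′ (image odd t (add p R))) (image even t E₁) (image even t E₂)

  Table : Set
  Table = Trie 15

  value : Table → Node → ℕ
  value τ q = lookup (encode q) τ

  -- One round of relaxation for longest walks, in which a column counts 1 less 12 for each marked
  -- edge (truncated at 0); the successors of improved nodes are queued for the next round.
  layer : List (Node × ℕ) → Table → List (Node × ℕ) → Table × List (Node × ℕ)
  layer [] τ next = τ , next
  layer ((q , x) ∷ ws) τ next =
    if x ≤ᵇ value τ q then layer ws τ next else
    layer ws (insert (encode q) x τ) (foldr pushes next (steps (odd , phase q)))
    where
    push : Phase → Column → List (Node × ℕ) → List (Node × ℕ)
    push p′ t ns = if dead q p′ t then ns else (succ q p′ t , suc x ∸ 12 * ∣ t ∣ᶜ) ∷ ns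

    pushes : Column × State → List (Node × ℕ) → List (Node × ℕ)
    pushes (c , _ , p′) ns = foldr (push p′) ns (submarks (allowed c))

  grow : ℕ → List (Node × ℕ) → Table → Table
  grow zero    ws       τ = τ
  grow (suc k) []       τ = τ
  grow (suc k) (w ∷ ws) τ = case layer (w ∷ ws) τ [] of λ (τ′ , ws′) → grow k ws′ τ′

  initial : Node
  initial = node false phase₀ ⟦ false , false , false , false ⟧ (only even₁) (only even₂)

  -- The column can complete a turn: it contains the starting edge again, M is back in its first
  -- phase, and neither even walk has closed up.
  closing : Node → Column → Bool
  closing q t =
    (mark ⊑ᵇ t ∧ phase q ≡ᵖ phase₀) ∧ (not (evens₁ q ∋ even₁) ∧ not (evens₂ q ∋ even₂))

  -- Applied to the last column, which contains the starting edge again: n + 12 ≤ 12 ∣S∣ in terms of the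
  -- potential, except that ∣S∣ = 1 is only possible for n ≤ 10.
  bounded : Node → ℕ → Column → Bool
  bounded q x t =
    if met q ∨ (1 <ᵇ ∣ t ∣ᶜ) then x + 13 ≤ᵇ offset + 12 * ∣ t ∣ᶜ else x <ᵇ offset + 10

  -- A positive value says that the successor is itself in the table, so the local inequalities
  -- continue along the whole walk.
  covers : Table → Node → ℕ → Column → Node → Bool
  covers τ q x t q′ =
    ((0 <ᵇ value τ q′) ∧ (suc x ≤ᵇ value τ q′ + 12 * ∣ t ∣ᶜ)) ∧ (not (closing q′ t) ∨ bounded q x t)

  goodMove : Table → Node → ℕ → Column × State → Bool
  goodMove τ q x (c , _ , p′) =
    all (λ t → dead q p′ t ∨ covers τ q x t (succ q p′ t)) (submarks (allowed c))

  good : Table → Node → ℕ → Bool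
  good τ q x = all (goodMove τ q x) (steps (odd , phase q))

  check : Table → Bool
  check τ = (offset ≡ᵇ value τ initial) ∧ every (λ k x → good τ (decode k) x) τ

  -- 100 rounds are enough; nothing depends on this, since `check` verifies the outcome.
  table : Table
  table = grow 100 ((initial , offset) ∷ []) none

  certificate : Bool
  certificate = check table

-- The phases are those possible behind a column containing the mark. The odd alternatives get
-- separate starts; the even ones are followed together.
fromSpoke fromOuter₀ fromOuter₁ fromInner₁ fromInner₃ : Start
fromSpoke  = start true  rung                      p₂ p₀ p₀
fromOuter₀ = start false ⟨ false , true  , false ⟩ p₀ p₁ p₂
fromOuter₁ = start false ⟨ false , true  , false ⟩ p₁ p₁ p₂
fromInner₁ = start false ⟨ false , false , true  ⟩ p₁ p₁ p₃
fromInner₃ = start false ⟨ false , false , true  ⟩ p₃ p₁ p₃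

spoke-certificate : certificate fromSpoke ≡ true
spoke-certificate = refl

outer₀-certificate : certificate fromOuter₀ ≡ true
outer₀-certificate = refl

outer₁-certificate : certificate fromOuter₁ ≡ true
outer₁-certificate = refl

inner₁-certificate : certificate fromInner₁ ≡ true
inner₁-certificate = refl

inner₃-certificate : certificate fromInner₃ ≡ true
inner₃-certificate = refl

-- Reflection of the Boolean checks.

∧⁻ : ∀ {a b} → T (a ∧ b) → T a × T b
∧⁻ = Equivalence.to T-∧

∧⁺ : ∀ {a b} → T a × T b → T (a ∧ b)
∧⁺ = Equivalence.from T-∧

∨⁻ : ∀ {a b} → T (a ∨ b) → T a ⊎ T b
∨⁻ = Equivalence.to T-∨

not⁺ : ∀ {b} → ¬ T b → T (not b)
not⁺ {false} _ = _
not⁺ {true}  h = h _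

not⁻ : ∀ {b} → T (not b) → ¬ T b
not⁻ {false} _ ()

all-∈ : ∀ {A : Set} {f : A → Bool} {xs x} → T (all f xs) → x ∈ₗ xs → T (f x)
all-∈ {f = f} p = All.lookup (all⁺ f _ p)

infix 4 _⊑_
_⊑_ : Column → Column → Set
t ⊑ c = T (t ⊑ᵇ c)

infix 4 _∈ₚ_
_∈ₚ_ : Phase → PhaseSet → Set
p ∈ₚ X = T (X ∋ p)

≡ᵖ-sound : ∀ p q → T (p ≡ᵖ q) → p ≡ q
≡ᵖ-sound p₀ p₀ _ = refl
≡ᵖ-sound p₁ p₁ _ = refl
≡ᵖ-sound p₂ p₂ _ = refl
≡ᵖ-sound p₃ p₃ _ = refl

≡ᵖ-refl : ∀ p → T (p ≡ᵖ p)
≡ᵖ-refl p₀ = _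
≡ᵖ-refl p₁ = _
≡ᵖ-refl p₂ = _
≡ᵖ-refl p₃ = _

∈-phaseSet⁻ : ∀ f p → p ∈ₚ phaseSet f → T (f p)
∈-phaseSet⁻ f p₀ = id
∈-phaseSet⁻ f p₁ = id
∈-phaseSet⁻ f p₂ = id
∈-phaseSet⁻ f p₃ = id

∈-only⁻ : ∀ {p q} → q ∈ₚ only p → q ≡ p
∈-only⁻ {p} {q} = ≡ᵖ-sound q p ∘ ∈-phaseSet⁻ (_≡ᵖ p) q

∈-add⁻ : ∀ {p X q} → q ∈ₚ add p X → p ≡ q ⊎ q ∈ₚ X
∈-add⁻ {p} {X} {q} q∈ with ∨⁻ {p ≡ᵖ q} (∈-phaseSet⁻ (λ q → p ≡ᵖ q ∨ X ∋ q) q q∈)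
... | inj₁ e = inj₁ (≡ᵖ-sound p q e)
... | inj₂ h = inj₂ h

∈-remove⁻ : ∀ {p X q} → q ∈ₚ remove p X → p ≢ q × q ∈ₚ X
∈-remove⁻ {p} {X} {q} q∈ with p ≡ᵖ q in eq | ∧⁻ {not (p ≡ᵖ q)} (∈-phaseSet⁻ (λ q → not (p ≡ᵖ q) ∧ X ∋ q) q q∈)
... | false | _ , h = (λ { refl → subst T eq (≡ᵖ-refl p) }) , h

-- Each recorded phase stems from an actual step, so actual walks can be extended whenever the
-- automaton moves.
image-sound : ∀ π t X {q} → q ∈ₚ image π t X →
  ∃[ p ] ∃[ c ] p ∈ₚ X × (c , π , q) ∈ₗ steps (π , p) × t ⊑ c
image-sound odd t ⟦ a , b , c , d ⟧ {p₀} h = let x , y = ∧⁻ {d} h in p₃ , _ , x , here refl , y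
image-sound odd t ⟦ a , b , c , d ⟧ {p₁} h = let x , y = ∧⁻ {a} h in p₀ , _ , x , here refl , y
image-sound odd t ⟦ a , b , c , d ⟧ {p₂} h with ∨⁻ {a ∧ t ⊑ᵇ rung} h
... | inj₁ h = let x , y = ∧⁻ {a} h in p₀ , _ , x , there (here refl) , y
... | inj₂ h = let x , y = ∧⁻ {b} h in p₁ , _ , x , here refl , y
image-sound odd t ⟦ a , b , c , d ⟧ {p₃} h = let x , y = ∧⁻ {c} h in p₂ , _ , x , here refl , y
image-sound even t ⟦ a , b , c , d ⟧ {p₀} h with ∨⁻ {a ∧ t ⊑ᵇ rung} h
... | inj₁ h = let x , y = ∧⁻ {a} h in p₀ , _ , x , there (here refl) , y
... | inj₂ h = let x , y = ∧⁻ {d} h in p₃ , _ , x , here refl , y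
image-sound even t ⟦ a , b , c , d ⟧ {p₁} h = let x , y = ∧⁻ {a} h in p₀ , _ , x , here refl , y
image-sound even t ⟦ a , b , c , d ⟧ {p₂} h = let x , y = ∧⁻ {b} h in p₁ , _ , x , here refl , y
image-sound even t ⟦ a , b , c , d ⟧ {p₃} h = let x , y = ∧⁻ {c} h in p₂ , _ , x , here refl , y

steps-parity : ∀ π {p c π′ p′} → (c , π′ , p′) ∈ₗ steps (π , p) → π′ ≡ π
steps-parity π {p₀} (here refl)         = refl
steps-parity π {p₀} (there (here refl)) = refl
steps-parity π {p₁} (here refl)         = refl
steps-parity π {p₂} (here refl)         = refl
steps-parity π {p₃} (here refl)         = refl

steps-deterministic : ∀ s {c x y} → (c , x) ∈ₗ steps s → (c , y) ∈ₗ steps s → x ≡ y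
steps-deterministic (odd  , p₀) (here refl)         (here refl)         = refl
steps-deterministic (odd  , p₀) (there (here refl)) (there (here refl)) = refl
steps-deterministic (even , p₀) (here refl)         (here refl)         = refl
steps-deterministic (odd  , p₀) (here refl)         (there (here ()))
steps-deterministic (even , p₀) (here refl)         (there (here ()))
steps-deterministic (even , p₀) (there (here refl)) (there (here refl)) = refl
steps-deterministic (π    , p₁) (here refl)         (here refl)         = refl
steps-deterministic (π    , p₂) (here refl)         (here refl)         = refl
steps-deterministic (π    , p₃) (here refl)         (here refl)         = refl

submarks-complete : ∀ t c → t ⊑ c → t ∈ₗ submarks c
submarks-complete ⟨ x , y , z ⟩ ⟨ s , o , i ⟩ h =
  let hx , hyz = ∧⁻ {not x ∨ s} h ; hy , hz = ∧⁻ {not y ∨ o} hyz in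
  ∈-concatMap⁺ (λ x → concatMap (λ y → map (λ z → ⟨ x , y , z ⟩) (below i)) (below o))
    (Any.map (λ { refl → ∈-concatMap⁺ (λ y → map (λ z → ⟨ x , y , z ⟩) (below i))
      (Any.map (λ { refl → ∈-map⁺ _ (∈-below z i hz) }) (∈-below y o hy)) }) (∈-below x s hx))
  where
  ∈-below : ∀ x b → T (not x ∨ b) → x ∈ₗ below b
  ∈-below false b    _ = here refl
  ∈-below true  true _ = there (here refl)

every-sound : ∀ {n} (P : Vec Bool n → ℕ → Bool) τ → T (every P τ) →
  ∀ ks → 0 < lookup ks τ → T (P ks (lookup ks τ))
every-sound P (leaf x)   h []           _  = h
every-sound P (fork l r) h (false ∷ ks) lt = every-sound _ l (proj₁ (∧⁻ {every _ l} h)) ks lt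
every-sound P (fork l r) h (true  ∷ ks) lt = every-sound _ r (proj₂ (∧⁻ {every _ l} h)) ks lt
every-sound P none       h []           ()
every-sound P none       h (_ ∷ _)      ()

decode∘encode : ∀ q → decode (encode q) ≡ q
decode∘encode (node m p₀ ⟦ _ , _ , _ , _ ⟧ ⟦ _ , _ , _ , _ ⟧ ⟦ _ , _ , _ , _ ⟧) = refl
decode∘encode (node m p₁ ⟦ _ , _ , _ , _ ⟧ ⟦ _ , _ , _ , _ ⟧ ⟦ _ , _ , _ , _ ⟧) = refl
decode∘encode (node m p₂ ⟦ _ , _ , _ , _ ⟧ ⟦ _ , _ , _ , _ ⟧ ⟦ _ , _ , _ , _ ⟧) = refl
decode∘encode (node m p₃ ⟦ _ , _ , _ , _ ⟧ ⟦ _ , _ , _ , _ ⟧ ⟦ _ , _ , _ , _ ⟧) = refl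

-- Runs and trajectories.

Along : (ℕ → Column → Set) → ℕ → List Column → Set
Along R k []       = ⊤
Along R k (c ∷ cs) = R k c × Along R (suc k) cs

Marked Follows : (ℕ → Column) → ℕ → List Column → Set
Marked  t = Along λ k c → t k ⊑ c
Follows m = Along λ k c → m k ≡ c

along-∷ʳ⁺ : ∀ {R} k cs {c} → Along R k cs → R (k + length cs) c → Along R k (cs ∷ʳ c)
along-∷ʳ⁺ {R} k []       {c} _       r = subst (λ j → R j c) (+-identityʳ k) r , _
along-∷ʳ⁺ {R} k (_ ∷ cs) {c} (a , h) r = a , along-∷ʳ⁺ (suc k) cs h (subst (λ j → R j c) (+-suc k (length cs)) r)

along-∷ʳ⁻ : ∀ {R} k cs {c} → Along R k (cs ∷ʳ c) → Along R k cs × R (k + length cs) c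
along-∷ʳ⁻ {R} k []       {c} (r , _) = _ , subst (λ j → R j c) (sym (+-identityʳ k)) r
along-∷ʳ⁻ {R} k (_ ∷ cs) {c} (a , h) = let h′ , r = along-∷ʳ⁻ (suc k) cs h in
  (a , h′) , subst (λ j → R j c) (sym (+-suc k (length cs))) r

length-∷ʳ : ∀ (cs : List Column) {c} → length (cs ∷ʳ c) ≡ suc (length cs)
length-∷ʳ cs = trans (length-++ cs) (+-comm (length cs) 1)

infixr 5 _∷_
data Run : State → List Column → State → Set where
  []  : ∀ {s} → Run s [] s
  _∷_ : ∀ {s c x cs y} → (c , x) ∈ₗ steps s → Run x cs y → Run s (c ∷ cs) y

run-∷ʳ : ∀ {s cs x c y} → Run s cs x → (c , y) ∈ₗ steps x → Run s (cs ∷ʳ c) y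
run-∷ʳ []      h = h ∷ []
run-∷ʳ (a ∷ r) h = a ∷ run-∷ʳ r h

record Trajectory : Set where
  field
    m    : ℕ → Column
    μ    : ℕ → State
    step : ∀ k → (m k , μ (suc k)) ∈ₗ steps (μ k)

total : (ℕ → ℕ) → ℕ → ℕ
total f zero    = 0
total f (suc k) = total f k + f k

-- The state between columns k and k + 1, as membership of uu (k - 1), uu k and vv k.
bits : State → Bool × Bool × Bool
bits (odd  , p₀) = false , true  , false
bits (odd  , p₁) = true  , true  , true
bits (odd  , p₂) = true  , false , false
bits (odd  , p₃) = false , false , true
bits (even , p₀) = false , false , false
bits (even , p₁) = false , true  , true
bits (even , p₂) = true  , true  , false
bits (even , p₃) = true  , false , true

fromBits : Bool × Bool × Bool → State
fromBits (false , true  , false) = odd  , p₀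
fromBits (true  , true  , true ) = odd  , p₁
fromBits (true  , false , false) = odd  , p₂
fromBits (false , false , true ) = odd  , p₃
fromBits (false , false , false) = even , p₀
fromBits (false , true  , true ) = even , p₁
fromBits (true  , true  , false) = even , p₂
fromBits (true  , false , true ) = even , p₃

fromBits∘bits : ∀ s → fromBits (bits s) ≡ s
fromBits∘bits (odd  , p₀) = refl
fromBits∘bits (odd  , p₁) = refl
fromBits∘bits (odd  , p₂) = refl
fromBits∘bits (odd  , p₃) = refl
fromBits∘bits (even , p₀) = refl
fromBits∘bits (even , p₁) = refl
fromBits∘bits (even , p₂) = refl
fromBits∘bits (even , p₃) = refl

bits-injective : ∀ {s s′} → bits s ≡ bits s′ → s ≡ s′
bits-injective eq = trans (sym (fromBits∘bits _)) (trans (cong fromBits eq) (fromBits∘bits _))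

bits-step : ∀ s {c x} → (c , x) ∈ₗ steps s → bits x ≡ (proj₁ (proj₂ (bits s)) , outer c , inner c)
bits-step (odd  , p₀) (here refl)         = refl
bits-step (odd  , p₀) (there (here refl)) = refl
bits-step (odd  , p₁) (here refl)         = refl
bits-step (odd  , p₂) (here refl)         = refl
bits-step (odd  , p₃) (here refl)         = refl
bits-step (even , p₀) (here refl)         = refl
bits-step (even , p₀) (there (here refl)) = refl
bits-step (even , p₁) (here refl)         = refl
bits-step (even , p₂) (here refl)         = refl
bits-step (even , p₃) (here refl)         = refl

module _ (𝓣 : Trajectory) where
  open Trajectory 𝓣

  -- A state records three edges from the two columns before its cut, so two common columns fix it
  -- whatever the initial state was.
  follows-end : ∀ k {s} cs {y} → Run s cs y → Follows m k cs → 2 ≤ length cs → μ (k + length cs) ≡ y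
  follows-end k (_ ∷ []) _ _ (s≤s ())
  follows-end k {s} (c ∷ c′ ∷ []) {y} (_∷_ {x = x} a (a′ ∷ [])) (refl , refl , _) _ =
    subst (λ j → μ j ≡ y) (sym (+-comm k 2)) (bits-injective (begin
      bits (μ (2 + k))                                      ≡⟨ bits-step _ (step (suc k)) ⟩
      behind (bits (μ (suc k)))                             ≡⟨ cong behind (bits-step _ (step k)) ⟩
      (outer (m k) , outer (m (suc k)) , inner (m (suc k))) ≡⟨ cong behind (bits-step _ a) ⟨
      behind (bits x)                                       ≡⟨ bits-step _ a′ ⟨
      bits y                                                ∎))
    where
    open ≡-Reasoning
    behind : Bool × Bool × Bool → Bool × Bool × Bool
    behind (_ , b , _) = b , outer (m (suc k)) , inner (m (suc k))
  follows-end k (_ ∷ cs@(_ ∷ _ ∷ _)) {y} (_ ∷ r) (_ , f) _ =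
    subst (λ j → μ j ≡ y) (sym (+-suc k (length cs))) (follows-end (suc k) cs r f (s≤s (s≤s z≤n)))

  stays-odd : ∀ k j → proj₁ (μ k) ≡ odd → proj₁ (μ (j + k)) ≡ odd
  stays-odd k zero    h = h
  stays-odd k (suc j) h = trans (steps-parity _ (step (j + k))) (stays-odd k j h)

  -- Closed runs of length n are the perfect matchings; this is the forcing property of the marks in
  -- terms of columns, for runs of either parity.
  Forcing : ℕ → (ℕ → Column) → Set
  Forcing n t = ∀ {s cs} → Run s cs s → length cs ≡ n → Marked t 0 cs → Follows m 0 cs

-- Soundness of the automaton.

module Soundness
  (𝓣 : Trajectory) (t : ℕ → Column) (n′ : ℕ) (n≥11 : 11 ≤ suc n′) (forcing : Forcing 𝓣 (suc n′) t)
  (closed : Trajectory.μ 𝓣 (suc n′) ≡ Trajectory.μ 𝓣 0) (marked : ∀ k → t k ⊑ Trajectory.m 𝓣 k)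
  (ι : Start) (τ : Table ι) (ok : T (check ι τ)) (start-phase : Trajectory.μ 𝓣 0 ≡ (odd , Start.phase₀ ι))
  (start-mark : Start.mark ι ⊑ t n′) (allows : ∀ k → t k ⊑ allowed ι (Trajectory.m 𝓣 k))
  where

  open Trajectory 𝓣
  open Start ι

  n : ℕ
  n = suc n′

  record Walk (s : State) (i : ℕ) (x : State) : Set where
    constructor walk
    field
      {cols} : List Column
      run    : Run s cols x
      len    : length cols ≡ i
      marks  : Marked t 0 cols
  open Walk

  infixl 5 _▻_
  _▻_ : ∀ {s i x c y} → Walk s i x → (c , y) ∈ₗ steps x × t i ⊑ c → Walk s (suc i) y
  w ▻ (a , b) = walk (run-∷ʳ (run w) a) (trans (length-∷ʳ (cols w)) (cong suc (len w)))
    (along-∷ʳ⁺ 0 (cols w) (marks w) (subst (λ i → t i ⊑ _) (sym (len w)) b))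

  own : ∀ i → Σ[ w ∈ Walk (μ 0) i (μ i) ] Follows m 0 (cols w)
  own zero    = walk [] refl _ , _
  own (suc i) = let w , f = own i in
    w ▻ (step i , marked i) , along-∷ʳ⁺ 0 (cols w) f (cong m (len w))

  Stray : ℕ → State → Set
  Stray i x = Σ[ w ∈ Walk (μ 0) i x ] ¬ Follows m 0 (cols w)

  prolong : ∀ {i x c y} → Stray i x → (c , y) ∈ₗ steps x × t i ⊑ c → Stray (suc i) y
  prolong (w , ¬f) a = w ▻ a , ¬f ∘ proj₁ ∘ along-∷ʳ⁻ 0 (cols w)

  diverge : ∀ {i c y} → (c , y) ∈ₗ steps (μ i) × t i ⊑ c → y ≢ μ (suc i) → Stray (suc i) y
  diverge {i} a ne = let w , _ = own i in w ▻ a , λ f →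
    ne (steps-deterministic (μ i) (proj₁ a)
      (subst (λ c → (c , _) ∈ₗ _) (trans (cong m (sym (len w))) (proj₂ (along-∷ʳ⁻ 0 (cols w) f))) (step i)))

  -- A stray walk that meets M again can follow M to the end and close up there, which yields a
  -- second perfect matching through the marks.
  ¬rejoin : ∀ {i} → i ≤ n → ¬ Stray i (μ i)
  ¬rejoin {i} i≤n s = let k , eq = m≤n⇒∃[o]m+o≡n i≤n in
    let w , ¬f = subst (λ j → Stray j (μ j)) (trans (+-comm k i) eq) (go k) in
    ¬f (forcing (subst (Run _ (cols w)) closed (run w)) (len w) (marks w))
    where
    go : ∀ k → Stray (k + i) (μ (k + i))
    go zero    = s
    go (suc k) = prolong (go k) (step (k + i) , marked (k + i))

  -- Forcing gives the closed walk the columns of M, hence by `follows-end` also the state of M at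
  -- n; but that state is odd.
  ¬even-closes : ∀ {p} → ¬ Walk (even , p) n (even , p)
  ¬even-closes {p} w =
    case trans (sym start-phase) (trans (sym closed) (subst (λ j → μ j ≡ (even , p)) (len w)
      (follows-end 𝓣 0 (cols w) (run w) (forcing (run w) (len w) (marks w))
        (subst (2 ≤_) (sym (len w)) (≤-trans (s≤s (s≤s z≤n)) n≥11))))) of λ ()

  weight : ℕ → ℕ
  weight = total (λ k → ∣ t k ∣ᶜ)

  -- What a node asserts after i columns; `bound` is the telescoped inequality of the potential.
  record Invariant (i : ℕ) (q : Node) : Set where
    field
      phase-ok : μ i ≡ (odd , phase q)
      stray-ok : ∀ {p} → p ∈ₚ strays q → Stray i (odd , p)
      even₁-ok : ∀ {p} → p ∈ₚ evens₁ q → Walk (even , even₁) i (even , p)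
      even₂-ok : ∀ {p} → p ∈ₚ evens₂ q → Walk (even , even₂) i (even , p)
      unmet    : T (met q) ⊎ weight i ≡ 0
      positive : 0 < value ι τ q
      bound    : i + offset ≤ value ι τ q + 12 * weight i
  open Invariant

  initial-invariant : Invariant 0 (initial ι)
  initial-invariant = record
    { phase-ok = start-phase
    ; stray-ok = λ {p} h → ⊥-elim (empty p h)
    ; even₁-ok = λ h → subst (λ p → Walk _ 0 (even , p)) (sym (∈-only⁻ h)) (walk [] refl _)
    ; even₂-ok = λ h → subst (λ p → Walk _ 0 (even , p)) (sym (∈-only⁻ h)) (walk [] refl _)
    ; unmet    = inj₂ refl
    ; positive = subst (0 <_) offset≡ (s≤s z≤n)
    ; bound    = ≤-reflexive (trans offset≡ (sym (+-identityʳ _)))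
    }
    where
    offset≡ : offset ≡ value ι τ (initial ι)
    offset≡ = ≡ᵇ⇒≡ offset _ (proj₁ (∧⁻ {offset ≡ᵇ value ι τ (initial ι)} ok))
    empty : ∀ p → ¬ p ∈ₚ ⟦ false , false , false , false ⟧
    empty p₀ ()
    empty p₁ ()
    empty p₂ ()
    empty p₃ ()

  module Advance {i : ℕ} {q : Node} (i<n : i < n) (inv : Invariant i q) where

    p′ : Phase
    p′ = proj₂ (μ (suc i))

    q′ : Node
    q′ = succ ι q p′ (t i)

    from-odd : ∀ {c y} → (c , y) ∈ₗ steps (odd , phase q) → (c , y) ∈ₗ steps (μ i)
    from-odd = subst (λ s → _ ∈ₗ steps s) (sym (phase-ok inv))

    next-odd : μ (suc i) ≡ (odd , p′)
    next-odd = cong (_, p′) (trans (steps-parity _ (step i)) (cong proj₁ (phase-ok inv)))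

    move : (m i , odd , p′) ∈ₗ steps (odd , phase q)
    move = subst₂ (λ x s → (m i , x) ∈ₗ steps s) next-odd (phase-ok inv) (step i)

    good-node : T (good ι τ q (value ι τ q))
    good-node = subst (λ r → T (good ι τ r (value ι τ q))) (decode∘encode q)
      (every-sound (λ k x → good ι τ (decode k) x) τ
        (proj₂ (∧⁻ {offset ≡ᵇ value ι τ (initial ι)} ok)) (encode q) (positive inv))

    alive : ¬ T (dead ι q p′ (t i))
    alive h = let p , c , p∈ , a , b = image-sound odd (t i) (strays q) h in
      ¬rejoin i<n (subst (Stray (suc i)) (sym next-odd) (prolong (stray-ok inv {p} p∈) (a , b)))

    covered : T (covers ι τ q (value ι τ q) (t i) q′)
    covered = [ ⊥-elim ∘ alive , id ]′ (∨⁻ {dead ι q p′ (t i)}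
      (all-∈ (all-∈ good-node move) (submarks-complete (t i) (allowed ι (m i)) (allows i))))

    -- The walk either leaves M at this very column or prolongs an earlier stray.
    strays′ : ∀ {p} → p ∈ₚ strays q′ → Stray (suc i) (odd , p)
    strays′ {p} h = let ne , h′ = ∈-remove⁻ {p′} {image odd (t i) (add (phase q) (strays q))} {p} h in
      let p° , c , p°∈ , a , b = image-sound odd (t i) (add (phase q) (strays q)) {p} h′ in
      case ∈-add⁻ {phase q} {strays q} {p°} p°∈ of λ where
        (inj₁ e°)   → diverge (from-odd (subst (λ r → (c , odd , p) ∈ₗ steps (odd , r)) (sym e°) a) , b)
                        λ e → ne (cong proj₂ (trans (sym next-odd) (sym e)))
        (inj₂ p°∈R) → prolong (stray-ok inv {p°} p°∈R) (a , b)

    evens′ : ∀ {e p} X → (∀ {p} → p ∈ₚ X → Walk e i (even , p)) →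
      p ∈ₚ image even (t i) X → Walk e (suc i) (even , p)
    evens′ {p = p} X h p∈ = let p° , c , p°∈ , a , b = image-sound even (t i) X {p} p∈ in h {p°} p°∈ ▻ (a , b)

    unmet′ : T (met q′) ⊎ weight (suc i) ≡ 0
    unmet′ with met q | unmet inv | ∣ t i ∣ᶜ
    ... | true  | _      | _     = inj₁ _
    ... | false | inj₂ e | zero  = inj₂ (cong (_+ 0) e)
    ... | false | _      | suc _ = inj₁ _

    invariant : Invariant (suc i) q′
    invariant = record
      { phase-ok = next-odd
      ; stray-ok = λ {p} → strays′ {p}
      ; even₁-ok = λ {p} → evens′ {p = p} (evens₁ q) (λ {p} → even₁-ok inv {p})
      ; even₂-ok = λ {p} → evens′ {p = p} (evens₂ q) (λ {p} → even₂-ok inv {p})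
      ; unmet    = unmet′
      ; positive = <ᵇ⇒< 0 _ (proj₁ pe)
      ; bound    = begin
          suc i + offset                                  ≤⟨ s≤s (bound inv) ⟩
          suc (value ι τ q) + 12 * weight i               ≤⟨ +-monoˡ-≤ (12 * weight i)
            (≤ᵇ⇒≤ (suc (value ι τ q)) (value ι τ q′ + 12 * ∣ t i ∣ᶜ) (proj₂ pe)) ⟩
          value ι τ q′ + 12 * ∣ t i ∣ᶜ + 12 * weight i     ≡⟨ regroup (value ι τ q′) (∣ t i ∣ᶜ) (weight i) ⟩
          value ι τ q′ + 12 * weight (suc i)              ∎
      }
      where
      open ≤-Reasoning
      regroup : ∀ x a w → x + 12 * a + 12 * w ≡ x + 12 * (w + a)
      regroup = solve-∀
      pe : T (0 <ᵇ value ι τ q′) × T (suc (value ι τ q) ≤ᵇ value ι τ q′ + 12 * ∣ t i ∣ᶜ)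
      pe = ∧⁻ {0 <ᵇ value ι τ q′} (proj₁ (∧⁻ {(0 <ᵇ value ι τ q′) ∧ _} covered))

  -- The closing inequality added to the telescoped one. In 13 = 12 + 1 the 1 accounts for the last
  -- column, which n′ omits.
  slack : ∀ k x a → x + 13 ≤ k + 12 * a → n′ + k ≤ x + 12 * weight n′ → n + 12 ≤ 12 * (weight n′ + a)
  slack k x a p r = +-cancelˡ-≤ (x + k) _ _ (begin
    (x + k) + (n + 12)                       ≡⟨ lhs x k n′ ⟩
    (x + 13) + (n′ + k)                      ≤⟨ +-mono-≤ p r ⟩
    (k + 12 * a) + (x + 12 * weight n′)      ≡⟨ rhs x k a (weight n′) ⟩
    (x + k) + 12 * (weight n′ + a)           ∎)
    where
    open ≤-Reasoning
    lhs : ∀ x k n → (x + k) + (suc n + 12) ≡ (x + 13) + (n + k)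
    lhs = solve-∀
    rhs : ∀ x k a w → (k + 12 * a) + (x + 12 * w) ≡ (x + k) + 12 * (w + a)
    rhs = solve-∀

  reach : ∀ i → i ≤ n → ∃[ q ] Invariant i q
  reach zero    _   = _ , initial-invariant
  reach (suc i) i<n = _ , Advance.invariant i<n (proj₂ (reach i (<⇒≤ i<n)))

  -- The automaton is run for n′ columns; forcing makes the last column a closing one, so the
  -- inequality at its closing applies.
  bounded⁺ : n + 12 ≤ 12 * weight n
  bounded⁺ with reach n′ (n≤1+n n′)
  ... | q , inv = conclude
    where
    open Advance ≤-refl inv

    closes : T (closing ι q′ (t n′))
    closes = ∧⁺
      ( ∧⁺ (start-mark , subst (λ p → T (p ≡ᵖ phase₀)) (sym (cong proj₂ (trans closed start-phase))) (≡ᵖ-refl phase₀))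
      , ∧⁺ ( not⁺ (λ h → ¬even-closes (even₁-ok invariant {even₁} h))
           , not⁺ (λ h → ¬even-closes (even₂-ok invariant {even₂} h))))

    fits : T (bounded ι q (value ι τ q) (t n′))
    fits = [ (λ h → ⊥-elim (not⁻ h closes)) , id ]′ (∨⁻ {not (closing ι q′ (t n′))}
      (proj₂ (∧⁻ {(0 <ᵇ value ι τ q′) ∧ _} covered)))

    conclude : n + 12 ≤ 12 * weight n
    conclude with met q | unmet inv | 1 <ᵇ ∣ t n′ ∣ᶜ | fits
    -- No mark among the first n′ columns and at most one in the last: the table then gives n′ < 10,
    -- against n ≥ 11.
    ... | false | inj₂ e | false | f = ⊥-elim (<-irrefl refl (begin-strict
      n′ + offset                      ≤⟨ bound inv ⟩
      value ι τ q + 12 * weight n′     ≡⟨ cong (λ z → value ι τ q + 12 * z) e ⟩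
      value ι τ q + 0                  ≡⟨ +-identityʳ _ ⟩
      value ι τ q                      <⟨ <ᵇ⇒< _ _ f ⟩
      offset + 10                      ≡⟨ +-comm offset 10 ⟩
      10 + offset                      ≤⟨ +-monoˡ-≤ offset (s≤s⁻¹ n≥11) ⟩
      n′ + offset                      ∎))
      where open ≤-Reasoning
    ... | true  | _ | _    | f = slack offset (value ι τ q) (∣ t n′ ∣ᶜ) (≤ᵇ⇒≤ _ _ f) (bound inv)
    ... | false | _ | true | f = slack offset (value ι τ q) (∣ t n′ ∣ᶜ) (≤ᵇ⇒≤ _ _ f) (bound inv)

-- Exactly one matching edge at a vertex of degree three.

one : Bool → Bool → Bool → Bool
one a b c = if a then not (b ∨ c) else (b xor c)

module _ {E : Set} (X : E → Bool) (I : E → Set) {e₁ e₂ e₃ : E}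
         (i₁ : I e₁) (i₂ : I e₂) (i₃ : I e₃) (e₁≢e₂ : e₁ ≢ e₂) (e₁≢e₃ : e₁ ≢ e₃) (e₂≢e₃ : e₂ ≢ e₃)
         (cover : ∀ e → I e → e ≡ e₁ ⊎ e ≡ e₂ ⊎ e ≡ e₃) where

  ∃!⇒one : (∃! _≡_ λ e → T (X e) × I e) → T (one (X e₁) (X e₂) (X e₃))
  ∃!⇒one (e , (x , i) , uniq) with cover e i
  ... | inj₁ refl        with X e₁ | X e₂ in q₂ | X e₃ in q₃
  ...   | true | true  | _     = e₁≢e₂ (uniq (subst T (sym q₂) _ , i₂))
  ...   | true | false | true  = e₁≢e₃ (uniq (subst T (sym q₃) _ , i₃))
  ...   | true | false | false = _
  ∃!⇒one (e , (x , i) , uniq) | inj₂ (inj₁ refl) with X e₁ in q₁ | X e₂ | X e₃ in q₃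
  ...   | true  | true | _     = ⊥-elim (e₁≢e₂ (sym (uniq (subst T (sym q₁) _ , i₁))))
  ...   | false | true | true  = e₂≢e₃ (uniq (subst T (sym q₃) _ , i₃))
  ...   | false | true | false = _
  ∃!⇒one (e , (x , i) , uniq) | inj₂ (inj₂ refl) with X e₁ in q₁ | X e₂ in q₂ | X e₃
  ...   | true  | _     | true = ⊥-elim (e₁≢e₃ (sym (uniq (subst T (sym q₁) _ , i₁))))
  ...   | false | true  | true = e₂≢e₃ (sym (uniq (subst T (sym q₂) _ , i₂)))
  ...   | false | false | true = _

  one⇒∃! : T (one (X e₁) (X e₂) (X e₃)) → ∃! _≡_ λ e → T (X e) × I e
  one⇒∃! h with X e₁ in q₁ | X e₂ in q₂ | X e₃ in q₃
  ... | true  | false | false = e₁ , (subst T (sym q₁) _ , i₁) , λ { {e} (x , i) → case cover e i of λ where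
    (inj₁ refl)        → refl
    (inj₂ (inj₁ refl)) → ⊥-elim (subst T q₂ x)
    (inj₂ (inj₂ refl)) → ⊥-elim (subst T q₃ x) }
  ... | false | true  | false = e₂ , (subst T (sym q₂) _ , i₂) , λ { {e} (x , i) → case cover e i of λ where
    (inj₁ refl)        → ⊥-elim (subst T q₁ x)
    (inj₂ (inj₁ refl)) → refl
    (inj₂ (inj₂ refl)) → ⊥-elim (subst T q₃ x) }
  ... | false | false | true  = e₃ , (subst T (sym q₃) _ , i₃) , λ { {e} (x , i) → case cover e i of λ where
    (inj₁ refl)        → ⊥-elim (subst T q₁ x)
    (inj₂ (inj₁ refl)) → ⊥-elim (subst T q₂ x)
    (inj₂ (inj₂ refl)) → refl }

-- The hypotheses are the matching conditions at the outer and the inner vertex of a column; their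
-- ten solutions are the ten steps between the eight states.
fromBits-step : ∀ a b c {s o i} → T (one a s o) → T (one c s i) →
  (⟨ s , o , i ⟩ , fromBits (b , o , i)) ∈ₗ steps (fromBits (a , b , c))
fromBits-step true  true  true  {false} {false} {false} _ _ = here refl
fromBits-step true  true  false {false} {false} {true}  _ _ = here refl
fromBits-step true  false true  {false} {false} {false} _ _ = here refl
fromBits-step true  false false {false} {false} {true}  _ _ = here refl
fromBits-step false true  true  {false} {true}  {false} _ _ = here refl
fromBits-step false true  false {false} {true}  {true}  _ _ = here refl
fromBits-step false true  false {true}  {false} {false} _ _ = there (here refl)
fromBits-step false false true  {false} {true}  {false} _ _ = here refl
fromBits-step false false false {false} {true}  {true}  _ _ = here refl
fromBits-step false false false {true}  {false} {false} _ _ = there (here refl)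

step-one : ∀ s {c x} → (c , x) ∈ₗ steps s →
  T (one (proj₁ (bits s)) (spoke c) (outer c)) × T (one (proj₂ (proj₂ (bits s))) (spoke c) (inner c))
step-one (odd  , p₀) (here refl)         = _
step-one (odd  , p₀) (there (here refl)) = _
step-one (odd  , p₁) (here refl)         = _
step-one (odd  , p₂) (here refl)         = _
step-one (odd  , p₃) (here refl)         = _
step-one (even , p₀) (here refl)         = _
step-one (even , p₀) (there (here refl)) = _
step-one (even , p₁) (here refl)         = _
step-one (even , p₂) (here refl)         = _
step-one (even , p₃) (here refl)         = _

-- Columns of a run and sums over a period.

at : List Column → ℕ → Column
at []       _       = ⟨ false , false , false ⟩
at (c ∷ cs) zero    = c
at (c ∷ cs) (suc k) = at cs k

stateAt : ∀ {s cs y} → Run s cs y → ℕ → State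
stateAt {s} _       zero    = s
stateAt {s} []      (suc k) = s
stateAt     (_ ∷ r) (suc k) = stateAt r k

stateAt-step : ∀ {s cs y} (r : Run s cs y) {k} → k < length cs →
  (at cs k , stateAt r (suc k)) ∈ₗ steps (stateAt r k)
stateAt-step (a ∷ [])    {zero}  _        = a
stateAt-step (a ∷ _ ∷ _) {zero}  _        = a
stateAt-step (a ∷ r)     {suc k} (s≤s lt) = stateAt-step r lt

stateAt-end : ∀ {s cs y} (r : Run s cs y) → stateAt r (length cs) ≡ y
stateAt-end []      = refl
stateAt-end (_ ∷ r) = stateAt-end r

total-cong : ∀ {f g} k → (∀ i → i < k → f i ≡ g i) → total f k ≡ total g k
total-cong zero    h = refl
total-cong (suc k) h = cong₂ _+_ (total-cong k λ i lt → h i (m<n⇒m<1+n lt)) (h k ≤-refl)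

total-head : ∀ f k → total f (suc k) ≡ f 0 + total (f ∘ suc) k
total-head f zero    = +-comm 0 (f 0)
total-head f (suc k) = trans (cong (_+ f (suc k)) (total-head f k)) (+-assoc (f 0) _ _)

-- Advancing the start from o to o + 1 drops `f o` and gains the equal term `f (o + n)`.
total-rotate : ∀ f n o → (∀ k → f (k + n) ≡ f k) → total (λ k → f (o + k)) n ≡ total f n
total-rotate f n zero    per = refl
total-rotate f n (suc o) per = begin
  total (λ k → f (suc o + k)) n ≡⟨ +-cancelˡ-≡ (f o) _ _ (begin
    f o + total (λ k → f (suc o + k)) n
      ≡⟨ cong₂ _+_ (cong f (sym (+-identityʳ o))) (total-cong n λ k _ → cong f (sym (+-suc o k))) ⟩
    f (o + 0) + total (λ k → f (o + suc k)) n ≡⟨ total-head (λ k → f (o + k)) n ⟨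
    total (λ k → f (o + k)) n + f (o + n)     ≡⟨ cong (total (λ k → f (o + k)) n +_) (per o) ⟩
    total (λ k → f (o + k)) n + f o           ≡⟨ +-comm _ (f o) ⟩
    f o + total (λ k → f (o + k)) n           ∎) ⟩
  total (λ k → f (o + k)) n ≡⟨ total-rotate f n o per ⟩
  total f n ∎
  where open ≡-Reasoning

length-filterᵇ : ∀ {A : Set} (p : A → Bool) xs → length (filterᵇ p xs) ≡ sum (map (bit ∘ p) xs)
length-filterᵇ p []       = refl
length-filterᵇ p (x ∷ xs) with p x
... | true  = cong suc (length-filterᵇ p xs)
... | false = length-filterᵇ p xs

total-+ : ∀ f g k → total (λ i → f i + g i) k ≡ total f k + total g k
total-+ f g zero    = refl
total-+ f g (suc k) = trans (cong (_+ (f k + g k)) (total-+ f g k)) (swap₄ (total f k) (total g k) (f k) (g k))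
  where
  swap₄ : ∀ a b c d → (a + b) + (c + d) ≡ (a + c) + (b + d)
  swap₄ = solve-∀

sum-tabulate : ∀ {n} (F : Fin n → ℕ) f → (∀ i → F i ≡ f (toℕ i)) → sum (tabulate F) ≡ total f n
sum-tabulate {zero}  F f h = refl
sum-tabulate {suc n} F f h =
  trans (cong₂ _+_ (h zero) (sum-tabulate (F ∘ suc) (f ∘ suc) (h ∘ suc))) (sym (total-head f n))

-- Arithmetic modulo n.

module _ {n : ℕ} .{{_ : NonZero n}} where

  mod-cong : ∀ {a b} → a % n ≡ b % n → a mod n ≡ b mod n
  mod-cong {a} {b} eq = toℕ-injective (trans (toℕ-fromℕ< (m%n<n a n)) (trans eq (sym (toℕ-fromℕ< (m%n<n b n)))))

  toℕ-mod : ∀ (i : Fin n) → toℕ i mod n ≡ i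
  toℕ-mod i = toℕ-injective (trans (toℕ-fromℕ< (m%n<n (toℕ i) n)) (m<n⇒m%n≡m (toℕ<n i)))

  %-+-% : ∀ a b → (a % n + b) % n ≡ (a + b) % n
  %-+-% a b = trans (%-distribˡ-+ (a % n) b n)
    (trans (cong (λ x → (x + b % n) % n) (m%n%n≡m%n a n)) (sym (%-distribˡ-+ a b n)))

  mod-⊕ : ∀ a b → (a mod n) ⊕ b ≡ (a + b) mod n
  mod-⊕ a b = mod-cong (trans (cong (λ x → (x + b) % n) (toℕ-fromℕ< (m%n<n a n))) (%-+-% a b))

  ⊕-⊕ : ∀ (i : Fin n) a b → i ⊕ a ⊕ b ≡ i ⊕ (a + b)
  ⊕-⊕ i a b = trans (mod-⊕ (toℕ i + a) b) (cong (_mod n) (+-assoc (toℕ i) a b))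

  ⊕-period : ∀ (i : Fin n) k → i ⊕ k * n ≡ i
  ⊕-period i k = trans (mod-cong ([m+kn]%n≡m%n (toℕ i) k n)) (toℕ-mod i)

  -- Here `k * pred n` acts as the negative of k modulo n, in place of a subtraction on indices.
  unshift : ∀ k → k + k * pred n ≡ k * n
  unshift k = trans (sym (*-suc k (pred n))) (cong (k *_) (suc-pred n))

  ⊖-⊕ : ∀ (i : Fin n) k → i ⊕ k * pred n ⊕ k ≡ i
  ⊖-⊕ i k = trans (⊕-⊕ i _ k) (trans (cong (i ⊕_) (trans (+-comm _ k) (unshift k))) (⊕-period i k))

  ⊕-injective : ∀ {i j : Fin n} k → i ⊕ k ≡ j ⊕ k → i ≡ j
  ⊕-injective {i} {j} k eq = begin
    i                    ≡⟨ ⊕-period i k ⟨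
    i ⊕ k * n            ≡⟨ cong (i ⊕_) (unshift k) ⟨
    i ⊕ (k + k * pred n) ≡⟨ ⊕-⊕ i k _ ⟨
    i ⊕ k ⊕ k * pred n   ≡⟨ cong (_⊕ k * pred n) eq ⟩
    j ⊕ k ⊕ k * pred n   ≡⟨ ⊕-⊕ j k _ ⟩
    j ⊕ (k + k * pred n) ≡⟨ cong (j ⊕_) (unshift k) ⟩
    j ⊕ k * n            ≡⟨ ⊕-period j k ⟩
    j                    ∎
    where open ≡-Reasoning

-- Perfect matchings of P(n) and closed runs.

module Columns (n : ℕ) .{{_ : NonZero n}} (n≥11 : 11 ≤ n) where

  PM : EdgeSet (P n) → Set
  PM = IsPerfectMatching {P n}

  n≥5 : 5 ≤ n
  n≥5 = ≤-trans (m≤m+n 5 6) n≥11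

  -- Vertices are addressed as `u (i ⊕ 2)` and `v (i ⊕ 1)`, so that the edges arriving from behind
  -- are `uu i` and `vv i`.
  LocallyPerfect : EdgeSet (P n) → Set
  LocallyPerfect X = ∀ i →
    T (one (X (uu i)) (X (uv (i ⊕ 2))) (X (uu (i ⊕ 2)))) ×
    T (one (X (vv i)) (X (uv (i ⊕ 1))) (X (vv (i ⊕ 1))))

  u-inj : ∀ {i j : Fin n} → u i ≡ u j → i ≡ j
  u-inj refl = refl

  v-inj : ∀ {i j : Fin n} → v i ≡ v j → i ≡ j
  v-inj refl = refl

  uu≢ : ∀ i → uu i ≢ uu (i ⊕ 2)
  uu≢ i eq = proj₁ (P-simple n≥5) (uu i) (cong (λ { (uu i) → u i ; e → u i }) eq)

  vv≢ : ∀ i → vv i ≢ vv (i ⊕ 1)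
  vv≢ i eq = proj₁ (P-simple n≥5) (vv i) (cong (λ { (vv i) → v i ; e → v i }) eq)

  cover-u : ∀ i e → Incident {P n} (u (i ⊕ 2)) e → e ≡ uu i ⊎ e ≡ uv (i ⊕ 2) ⊎ e ≡ uu (i ⊕ 2)
  cover-u i (uu j) (inj₁ eq) = inj₂ (inj₂ (cong uu (sym (u-inj eq))))
  cover-u i (uu j) (inj₂ eq) = inj₁ (cong uu (⊕-injective 2 (sym (u-inj eq))))
  cover-u i (uv j) (inj₁ eq) = inj₂ (inj₁ (cong uv (sym (u-inj eq))))
  cover-u i (uv j) (inj₂ ())
  cover-u i (vv j) (inj₁ ())
  cover-u i (vv j) (inj₂ ())

  cover-v : ∀ i e → Incident {P n} (v (i ⊕ 1)) e → e ≡ vv i ⊎ e ≡ uv (i ⊕ 1) ⊎ e ≡ vv (i ⊕ 1)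
  cover-v i (vv j) (inj₁ eq) = inj₂ (inj₂ (cong vv (sym (v-inj eq))))
  cover-v i (vv j) (inj₂ eq) = inj₁ (cong vv (⊕-injective 1 (sym (v-inj eq))))
  cover-v i (uv j) (inj₁ ())
  cover-v i (uv j) (inj₂ eq) = inj₂ (inj₁ (cong uv (sym (v-inj eq))))
  cover-v i (uu j) (inj₁ ())
  cover-v i (uu j) (inj₂ ())

  perfect⇒local : ∀ X → PM X → LocallyPerfect X
  perfect⇒local X pm i =
    ∃!⇒one X (Incident {P n} (u (i ⊕ 2))) (inj₂ refl) (inj₁ refl) (inj₁ refl)
      (λ ()) (uu≢ i) (λ ()) (cover-u i) (pm (u (i ⊕ 2))) ,
    ∃!⇒one X (Incident {P n} (v (i ⊕ 1))) (inj₂ refl) (inj₂ refl) (inj₁ refl)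
      (λ ()) (vv≢ i) (λ ()) (cover-v i) (pm (v (i ⊕ 1)))

  local⇒perfect : ∀ X → LocallyPerfect X → PM X
  local⇒perfect X loc (u j) = subst (λ j → ∃! _≡_ λ e → T (X e) × Incident {P n} (u j) e) (⊖-⊕ j 2) (
    one⇒∃! X (Incident {P n} (u (i ⊕ 2))) (inj₂ refl) (inj₁ refl) (inj₁ refl)
      (λ ()) (uu≢ i) (λ ()) (cover-u i) (proj₁ (loc i)))
    where i = j ⊕ 2 * pred n
  local⇒perfect X loc (v j) = subst (λ j → ∃! _≡_ λ e → T (X e) × Incident {P n} (v j) e) (⊖-⊕ j 1) (
    one⇒∃! X (Incident {P n} (v (i ⊕ 1))) (inj₂ refl) (inj₂ refl) (inj₁ refl)
      (λ ()) (vv≢ i) (λ ()) (cover-v i) (proj₂ (loc i)))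
    where i = j ⊕ 1 * pred n

  columnAt : EdgeSet (P n) → Fin n → Column
  columnAt X i = ⟨ X (uv i) , X (uu i) , X (vv i) ⟩

  column : EdgeSet (P n) → ℕ → Column
  column X k = columnAt X (k mod n)

  column-cong : ∀ X a b → a % n ≡ b % n → column X a ≡ column X b
  column-cong X a b eq = cong (columnAt X) (mod-cong {a = a} {b} eq)

  column-toℕ : ∀ X i → column X (toℕ i) ≡ columnAt X i
  column-toℕ X i = cong (columnAt X) (toℕ-mod i)

  column-gap : ∀ X i j → column X (j + suc (toℕ {n} i)) ≡ column X (toℕ i + suc j)
  column-gap X i j = cong (column X)
    (trans (+-suc j (toℕ i)) (trans (cong suc (+-comm j (toℕ i))) (sym (+-suc (toℕ i) j))))

  fromColumns : (ℕ → Column) → EdgeSet (P n)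
  fromColumns g (uv i) = spoke (g (toℕ i))
  fromColumns g (uu i) = outer (g (toℕ i))
  fromColumns g (vv i) = inner (g (toℕ i))

  column-fromColumns : ∀ g k → column (fromColumns g) k ≡ g (k % n)
  column-fromColumns g k = cong g (toℕ-fromℕ< (m%n<n k n))

  module _ (X : EdgeSet (P n)) (pm : PM X) where
    private
      C : ℕ → Column
      C = column X

    -- The state in front of column k: `n ∸ 2` and `n ∸ 1` stand for -2 and -1 modulo n.
    state : ℕ → State
    state k = fromBits (outer (C (k + (n ∸ 2))) , outer (C (k + (n ∸ 1))) , inner (C (k + (n ∸ 1))))

    back : ∀ k j → j ≤ n → k + (n ∸ j) + j ≡ k + n
    back k j j≤n = trans (+-assoc k _ j) (cong (k +_) (m∸n+n≡m j≤n))

    wrap : ∀ k → C (k + n) ≡ C k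
    wrap k = column-cong X (k + n) k ([m+n]%n≡m%n k n)

    ahead : ∀ k j → j ≤ n → columnAt X ((k + (n ∸ j)) mod n ⊕ j) ≡ C k
    ahead k j j≤n = trans (cong (columnAt X)
      (trans (mod-⊕ (k + (n ∸ j)) j) (cong (_mod n) (back k j j≤n)))) (wrap k)

    trajectory : Trajectory
    trajectory = record { m = C ; μ = state ; step = λ k →
      subst (λ z → (C k , fromBits z) ∈ₗ steps (state k)) (next k)
        (fromBits-step _ (outer (C (k + (n ∸ 1)))) _ (outer-one k) (inner-one k)) }
      where
      n≥1 : 1 ≤ n
      n≥1 = ≤-trans (m≤m+n 1 10) n≥11
      n≥2 : 2 ≤ n
      n≥2 = ≤-trans (m≤m+n 2 9) n≥11
      outer-one : ∀ k → T (one (outer (C (k + (n ∸ 2)))) (spoke (C k)) (outer (C k)))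
      outer-one k = subst (λ c → T (one (outer (C (k + (n ∸ 2)))) (spoke c) (outer c)))
        (ahead k 2 n≥2)
        (proj₁ (perfect⇒local X pm ((k + (n ∸ 2)) mod n)))
      inner-one : ∀ k → T (one (inner (C (k + (n ∸ 1)))) (spoke (C k)) (inner (C k)))
      inner-one k = subst (λ c → T (one (inner (C (k + (n ∸ 1)))) (spoke c) (inner c)))
        (ahead k 1 n≥1)
        (proj₂ (perfect⇒local X pm ((k + (n ∸ 1)) mod n)))
      next : ∀ k → (outer (C (k + (n ∸ 1))) , outer (C k) , inner (C k))
                 ≡ (outer (C (suc k + (n ∸ 2))) , outer (C (suc k + (n ∸ 1))) , inner (C (suc k + (n ∸ 1))))
      next k = cong₂ (λ c c′ → outer c , outer c′ , inner c′) (cong C e₁) (trans (sym (wrap k)) (cong C e₂))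
        where
        e₂ : k + n ≡ suc k + (n ∸ 1)
        e₂ = trans (sym (back k 1 n≥1)) (+-comm _ 1)
        e₁ : k + (n ∸ 1) ≡ suc k + (n ∸ 2)
        e₁ = +-cancelʳ-≡ 1 _ _ (trans (back k 1 n≥1) (trans (sym (back k 2 n≥2)) (+-suc _ 1)))

    state-period : ∀ k → state (k + n) ≡ state k
    state-period k = cong₂ (λ c c′ → fromBits (outer c , outer c′ , inner c′)) (shift (n ∸ 2)) (shift (n ∸ 1))
      where
      shift : ∀ j → C (k + n + j) ≡ C (k + j)
      shift j = trans
        (cong C (trans (+-assoc k n j) (trans (cong (k +_) (+-comm n j)) (sym (+-assoc k j n))))) (wrap (k + j))

  -- Since the run is closed, its cyclic repetition is again made of steps, and these contain the
  -- matching conditions; `d` rotates the starting column.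
  fromRun : ∀ {s cs} → Run s cs s → length cs ≡ n → ∀ d → PM (fromColumns λ k → at cs ((k + d) % n))
  fromRun {s} {cs} r len d = local⇒perfect _ λ i →
    subst (λ c → T (one (outer (g (toℕ i + d))) (spoke c) (outer c))) (eq i 2) (proj₁ (local (toℕ i + d))) ,
    subst (λ c → T (one (inner (g (toℕ i + d))) (spoke c) (inner c))) (eq i 1) (proj₂ (local (toℕ i + d)))
    where
    g : ℕ → Column
    g k = at cs (k % n)

    σ : ℕ → State
    σ k = stateAt r (k % n)

    eq : ∀ i k → g (k + (toℕ i + d)) ≡ at cs ((toℕ (i ⊕ k) + d) % n)
    eq i k = cong (at cs) (trans (cong (_% n) (trans (+-comm k _) (trans (+-assoc (toℕ i) d k)
      (trans (cong (toℕ i +_) (+-comm d k)) (sym (+-assoc (toℕ i) k d)))))) (sym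
      (trans (cong (λ x → (x + d) % n) (toℕ-fromℕ< (m%n<n (toℕ i + k) n))) (%-+-% (toℕ i + k) d))))

    suc-% : ∀ k → suc (k % n) % n ≡ suc k % n
    suc-% k = trans (cong (_% n) (+-comm 1 (k % n))) (trans (%-+-% k 1) (cong (_% n) (+-comm k 1)))

    σ-suc : ∀ k → stateAt r (suc (k % n)) ≡ σ (suc k)
    σ-suc k with suc (k % n) <? n
    ... | yes lt = cong (stateAt r) (trans (sym (m<n⇒m%n≡m lt)) (suc-% k))
    -- Behind the last column the closed run is back in its initial state.
    ... | no ≮   = trans (cong (stateAt r) end) (trans (trans (cong (stateAt r) (sym len)) (stateAt-end r))
                     (sym (cong (stateAt r) (trans (sym (suc-% k)) (trans (cong (_% n) end) (n%n≡0 n))))))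
      where
      end : suc (k % n) ≡ n
      end = ≤-antisym (m%n<n k n) (≮⇒≥ ≮)

    σ-step : ∀ k → (g k , σ (suc k)) ∈ₗ steps (σ k)
    σ-step k = subst (λ x → (g k , x) ∈ₗ steps (σ k)) (σ-suc k)
      (stateAt-step r (subst (k % n <_) (sym len) (m%n<n k n)))

    local : ∀ k → T (one (outer (g k)) (spoke (g (2 + k))) (outer (g (2 + k)))) ×
                  T (one (inner (g k)) (spoke (g (1 + k))) (inner (g (1 + k))))
    local k =
      subst (λ b → T (one b (spoke (g (2 + k))) (outer (g (2 + k)))))
        (trans (cong proj₁ (bits-step _ (σ-step (suc k)))) (cong (proj₁ ∘ proj₂) (bits-step _ (σ-step k))))
        (proj₁ (step-one _ (σ-step (2 + k)))) ,
      subst (λ b → T (one b (spoke (g (1 + k))) (inner (g (1 + k)))))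
        (cong (proj₂ ∘ proj₂) (bits-step _ (σ-step k)))
        (proj₂ (step-one _ (σ-step (1 + k))))

  size-total : ∀ S → size {P n} S ≡ total (λ k → ∣ column S k ∣ᶜ) n
  size-total S = begin
    length (filterᵇ S (map uu (allFin n) ++ map uv (allFin n) ++ map vv (allFin n)))
      ≡⟨ length-filterᵇ S (map uu (allFin n) ++ map uv (allFin n) ++ map vv (allFin n)) ⟩
    sum (map w (map uu (allFin n) ++ map uv (allFin n) ++ map vv (allFin n)))
      ≡⟨ split (map uu (allFin n)) _ ⟩
    sum (map w (map uu (allFin n))) + sum (map w (map uv (allFin n) ++ map vv (allFin n)))
      ≡⟨ cong (sum (map w (map uu (allFin n))) +_) (split (map uv (allFin n)) _) ⟩
    sum (map w (map uu (allFin n))) + (sum (map w (map uv (allFin n))) + sum (map w (map vv (allFin n))))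
      ≡⟨ cong₂ _+_ (each uu) (cong₂ _+_ (each uv) (each vv)) ⟩
    total (W uu) n + (total (W uv) n + total (W vv) n)
      ≡⟨ shuffle (total (W uu) n) (total (W uv) n) (total (W vv) n) ⟩
    total (W uv) n + (total (W uu) n + total (W vv) n)
      ≡⟨ cong (total (W uv) n +_) (total-+ (W uu) (W vv) n) ⟨
    total (W uv) n + total (λ k → W uu k + W vv k) n
      ≡⟨ total-+ (W uv) (λ k → W uu k + W vv k) n ⟨
    total (λ k → ∣ column S k ∣ᶜ) n ∎
    where
    open ≡-Reasoning
    w : Edge n → ℕ
    w = bit ∘ S
    W : (Fin n → Edge n) → ℕ → ℕ
    W e k = w (e (k mod n))
    split : ∀ xs ys → sum (map w (xs ++ ys)) ≡ sum (map w xs) + sum (map w ys)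
    split xs ys = trans (cong sum (map-++ w xs ys)) (sum-++ (map w xs) (map w ys))
    each : ∀ e → sum (map w (map e (allFin n))) ≡ total (W e) n
    each e = trans (cong sum (trans (sym (map-∘ (allFin n))) (map-tabulate id (w ∘ e))))
      (sum-tabulate (w ∘ e) (W e) (λ i → cong (w ∘ e) (sym (toℕ-mod i))))
    shuffle : ∀ a b c → a + (b + c) ≡ b + (a + c)
    shuffle a b c = trans (sym (+-assoc a b c)) (trans (cong (_+ c) (+-comm a b)) (+-assoc b a c))

-- Inclusion of columns and pointwise properties.

⇒⁺ : ∀ {a b} → (T a → T b) → T (not a ∨ b)
⇒⁺ {false} _ = _
⇒⁺ {true}  f = f _

⇒⁻ : ∀ {a b} → T (not a ∨ b) → T a → T b
⇒⁻ {true} h _ = h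

⊑⁺ : ∀ {t c} → (T (spoke t) → T (spoke c)) → (T (outer t) → T (outer c)) →
  (T (inner t) → T (inner c)) → t ⊑ c
⊑⁺ f g h = ∧⁺ (⇒⁺ f , ∧⁺ (⇒⁺ g , ⇒⁺ h))

⊑-spoke : ∀ {t c} → t ⊑ c → T (spoke t) → T (spoke c)
⊑-spoke {t} {c} h = ⇒⁻ (proj₁ (∧⁻ {not (spoke t) ∨ spoke c} h))

⊑-outer : ∀ {t c} → t ⊑ c → T (outer t) → T (outer c)
⊑-outer {t} {c} h = ⇒⁻ (proj₁ (∧⁻ {not (outer t) ∨ outer c} (proj₂ (∧⁻ {not (spoke t) ∨ spoke c} h))))

⊑-inner : ∀ {t c} → t ⊑ c → T (inner t) → T (inner c)
⊑-inner {t} {c} h = ⇒⁻ (proj₂ (∧⁻ {not (outer t) ∨ outer c} (proj₂ (∧⁻ {not (spoke t) ∨ spoke c} h))))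

T-ext : ∀ {a b} → T a ⇔ T b → a ≡ b
T-ext {false} {false} _ = refl
T-ext {true}  {true}  _ = refl
T-ext {false} {true}  h = ⊥-elim (Equivalence.from h _)
T-ext {true}  {false} h = ⊥-elim (Equivalence.to h _)

along-at⁺ : ∀ {R} k cs → (∀ j → j < length cs → R (k + j) (at cs j)) → Along R k cs
along-at⁺     k []       h = _
along-at⁺ {R} k (c ∷ cs) h =
  subst (λ j → R j c) (+-identityʳ k) (h 0 z<s) ,
  along-at⁺ (suc k) cs λ j lt → subst (λ i → R i (at cs j)) (+-suc k j) (h (suc j) (s<s lt))

along-at⁻ : ∀ {R} k cs → Along R k cs → ∀ j → j < length cs → R (k + j) (at cs j)
along-at⁻ {R} k (c ∷ cs) (r , _) zero    _        = subst (λ j → R j c) (sym (+-identityʳ k)) r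
along-at⁻ {R} k (c ∷ cs) (_ , h) (suc j) (s<s lt) =
  subst (λ i → R i (at cs j)) (sym (+-suc k j)) (along-at⁻ (suc k) cs h j lt)

-- Distances between consecutive spokes.

next : Phase → Phase
next p₀ = p₁
next p₁ = p₂
next p₂ = p₃
next p₃ = p₀

advance : ℕ → Phase → Phase
advance zero    p = p
advance (suc k) p = next (advance k p)

gapResidue : Parity → ℕ
gapResidue odd  = 2
gapResidue even = 0

-- Four slides restore every phase. The odd landing `p₂` is two slides short of `p₀`, and the even
-- landing is `p₀` itself.
advance-gap : ∀ π g → advance g (landing π) ≡ p₀ → g % 4 ≡ gapResidue π
advance-gap odd  0 ()
advance-gap odd  1 ()
advance-gap odd  2 _ = refl
advance-gap odd  3 ()
advance-gap even 0 _ = refl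
advance-gap even 1 ()
advance-gap even 2 ()
advance-gap even 3 ()
advance-gap π (suc (suc (suc (suc g)))) h =
  trans (trans (cong (_% 4) (+-comm 4 g)) ([m+n]%n≡m%n g 4)) (advance-gap π g (trans (sym (next⁴ _)) h))
  where
  next⁴ : ∀ p → next (next (next (next p))) ≡ p
  next⁴ p₀ = refl
  next⁴ p₁ = refl
  next⁴ p₂ = refl
  next⁴ p₃ = refl

step-slide : ∀ π p {c x} → (c , x) ∈ₗ steps (π , p) → ¬ T (spoke c) → x ≡ (π , next p)
step-slide π p₀ (here refl)         _  = refl
step-slide π p₀ (there (here refl)) ¬s = ⊥-elim (¬s _)
step-slide π p₁ (here refl)         _  = refl
step-slide π p₂ (here refl)         _  = refl
step-slide π p₃ (here refl)         _  = refl

step-spoke : ∀ π p {c x} → (c , x) ∈ₗ steps (π , p) → T (spoke c) → p ≡ p₀ × x ≡ (π , landing π)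
step-spoke odd  p₀ (here refl)         ()
step-spoke even p₀ (here refl)         ()
step-spoke π    p₀ (there (here refl)) _ = refl , refl
step-spoke odd  p₁ (here refl)         ()
step-spoke even p₁ (here refl)         ()
step-spoke odd  p₂ (here refl)         ()
step-spoke even p₂ (here refl)         ()
step-spoke odd  p₃ (here refl)         ()
step-spoke even p₃ (here refl)         ()

step-outer : ∀ p {c x} → (c , x) ∈ₗ steps (odd , p) → T (outer c) → x ≡ (odd , p₀) ⊎ x ≡ (odd , p₁)
step-outer p₀ (here refl)         _ = inj₂ refl
step-outer p₀ (there (here refl)) ()
step-outer p₁ (here refl)         ()
step-outer p₂ (here refl)         ()
step-outer p₃ (here refl)         _ = inj₁ refl

step-inner : ∀ p {c x} → (c , x) ∈ₗ steps (odd , p) → T (inner c) → x ≡ (odd , p₁) ⊎ x ≡ (odd , p₃)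
step-inner p₀ (here refl)         _ = inj₁ refl
step-inner p₀ (there (here refl)) ()
step-inner p₁ (here refl)         ()
step-inner p₂ (here refl)         _ = inj₂ refl
step-inner p₃ (here refl)         ()

module _ (𝓣 : Trajectory) where
  open Trajectory 𝓣

  glide : ∀ k g {π p} → μ k ≡ (π , p) → (∀ j → j < g → ¬ T (spoke (m (j + k)))) →
    μ (g + k) ≡ (π , advance g p)
  glide k zero    e _ = e
  glide k (suc g) {π} {p} e h = step-slide π (advance g p)
    (subst (λ s → (m (g + k) , μ (suc (g + k))) ∈ₗ steps s)
      (glide k g e λ j lt → h j (m<n⇒m<1+n lt)) (step (g + k)))
    (h g ≤-refl)

  gap-mod : ∀ k g {π} → μ k ≡ (π , landing π) → (∀ j → j < g → ¬ T (spoke (m (j + k)))) →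
    T (spoke (m (g + k))) → g % 4 ≡ gapResidue π
  gap-mod k g {π} e h s = advance-gap π g (proj₁ (step-spoke π _
    (subst (λ s → (m (g + k) , μ (suc (g + k))) ∈ₗ steps s) (glide k g e h) (step (g + k))) s))

shift : ℕ → Trajectory → Trajectory
shift o 𝓣 = record
  { m    = λ k → m (o + k)
  ; μ    = λ k → μ (o + k)
  ; step = λ k → subst (λ j → (m (o + k) , μ j) ∈ₗ steps (μ (o + k))) (sym (+-suc o k)) (step (o + k))
  }
  where open Trajectory 𝓣

-- The lower bound for forcing sets.

module Lower (n′ : ℕ) (n≥11 : 11 ≤ suc n′) where
  n : ℕ
  n = suc n′

  open Columns n n≥11

  module _ (X : EdgeSet (P n)) (pm : PM X) where
    private
      𝓣 = trajectory X pm
      C = column X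
      μ = state X pm

    state-periods : ∀ k j → μ (k + j * n) ≡ μ k
    state-periods k zero    = cong μ (+-identityʳ k)
    state-periods k (suc j) =
      trans (cong μ (trans (cong (k +_) (+-comm n (j * n))) (sym (+-assoc k (j * n) n))))
        (trans (state-period X pm (k + j * n)) (state-periods k j))

    -- Steps keep the parity, and `j + k * n` does not precede k; periodicity then transfers the
    -- parity to j.
    odd-everywhere : ∀ k → proj₁ (μ k) ≡ odd → ∀ j → proj₁ (μ j) ≡ odd
    odd-everywhere k h j = trans (cong proj₁ (trans (sym (state-periods j k)) (cong μ rearrange)))
      (stays-odd 𝓣 k (j + k * n′) h)
      where
      rearrange : j + k * n ≡ j + k * n′ + k
      rearrange = trans (cong (j +_) (trans (*-suc k n′) (+-comm k (k * n′)))) (sym (+-assoc j (k * n′) k))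

    𝓜₂⇒odd : 𝓜₂ n X → ∀ k → proj₁ (μ k) ≡ odd
    𝓜₂⇒odd (_ , inj₁ ((i , i∈) , gaps)) = odd-everywhere (suc (toℕ i)) (decide (μ (suc (toℕ i))) refl)
      where
      spoke-i : T (spoke (C (toℕ i)))
      spoke-i = subst (T ∘ spoke) (sym (column-toℕ X i)) i∈

      landed : ∀ s {x} → (C (toℕ i) , x) ∈ₗ steps s → x ≡ (proj₁ s , landing (proj₁ s))
      landed (π , p) a = proj₂ (step-spoke π p a spoke-i)

      decide : ∀ s → μ (suc (toℕ i)) ≡ s → proj₁ s ≡ odd
      decide (odd  , _) _ = refl
      -- In an even matching the first spoke after i would come after a gap divisible by 4, against
      -- (i). So no spoke follows at all, although spoke i itself returns after n columns.
      decide (even , _) e = ⊥-elim (spokeless n ≤-refl n′ ≤-refl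
        (subst (T ∘ spoke) (sym (trans (column-gap X i n′)
          (column-cong X (toℕ i + n) (toℕ i) ([m+n]%n≡m%n (toℕ i) n)))) spoke-i))
        where
        start-even : μ (suc (toℕ i)) ≡ (even , p₀)
        start-even = trans (landed (μ (toℕ i)) (Trajectory.step 𝓣 (toℕ i)))
          (cong (λ π → π , landing π) (trans (sym (steps-parity _ (Trajectory.step 𝓣 (toℕ i)))) (cong proj₁ e)))

        spokeless : ∀ g → g ≤ n → ∀ j → j < g → ¬ T (spoke (C (j + suc (toℕ i))))
        spokeless (suc g) g<n j j≤g s with m≤n⇒m<n∨m≡n (s≤s⁻¹ j≤g)
        ... | inj₁ j<g  = spokeless g (<⇒≤ g<n) j j<g s
        ... | inj₂ refl =
          case trans (sym (gap-mod 𝓣 (suc (toℕ i)) g start-even (spokeless g (<⇒≤ g<n)) s))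
            (gaps i g g<n i∈ (subst (T ∘ spoke) (column-gap X i g) s) λ k k<g s′ →
              spokeless g (<⇒≤ g<n) k k<g (subst (T ∘ spoke) (sym (column-gap X i k)) s′)) of λ ()
    -- In case (ii) the first block puts three matching edges across one cut, which is the odd state
    -- `p₁`.
    𝓜₂⇒odd (_ , inj₂ (_ , 4∣n , i , blocks)) = odd-everywhere (2 + k) (cong proj₁ odd-p₁)
      where
      k : ℕ
      k = toℕ i + 0

      first : 0 < n / 4
      first = m≥n⇒m/n>0 (≤-trans (m≤m+n 4 7) n≥11)

      true≡ : ∀ {b} → T b → b ≡ true
      true≡ {true} _ = refl

      outer-k : outer (C k) ≡ true
      outer-k = true≡ (Equivalence.from (blocks (uu (i ⊕ 0))) (0 , first , inj₁ refl))

      suc-k : suc k ≡ toℕ i + 1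
      suc-k = trans (cong suc (+-identityʳ (toℕ i))) (+-comm 1 (toℕ i))

      outer-suc-k : outer (C (suc k)) ≡ true
      outer-suc-k = trans (cong (outer ∘ C) suc-k)
        (true≡ (Equivalence.from (blocks (uu (i ⊕ 1))) (0 , first , inj₂ (inj₁ refl))))

      inner-suc-k : inner (C (suc k)) ≡ true
      inner-suc-k = trans (cong (inner ∘ C) suc-k)
        (true≡ (Equivalence.from (blocks (vv (i ⊕ 1))) (0 , first , inj₂ (inj₂ (inj₁ refl)))))

      odd-p₁ : μ (2 + k) ≡ (odd , p₁)
      odd-p₁ = bits-injective (begin
        bits (μ (2 + k))                                      ≡⟨ bits-step _ (Trajectory.step 𝓣 (suc k)) ⟩
        behind (bits (μ (suc k)))                             ≡⟨ cong behind (bits-step _ (Trajectory.step 𝓣 k)) ⟩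
        (outer (C k) , outer (C (suc k)) , inner (C (suc k))) ≡⟨ cong₂ _,_ outer-k (cong₂ _,_ outer-suc-k inner-suc-k) ⟩
        (true , true , true)                                  ∎)
        where
        open ≡-Reasoning
        behind : Bool × Bool × Bool → Bool × Bool × Bool
        behind (_ , b , _) = b , outer (C (suc k)) , inner (C (suc k))

    module _ (S : EdgeSet (P n)) (S-forces : IsForcingSet {P n} X S) where

      marks⊑ : ∀ k → column S k ⊑ C k
      marks⊑ k = ⊑⁺ (proj₁ S-forces (uv (k mod n))) (proj₁ S-forces (uu (k mod n))) (proj₁ S-forces (vv (k mod n)))

      -- A closed run read from column o is turned back into a perfect matching that contains S, and
      -- therefore equals X.
      forcing : ∀ o → Forcing (shift o 𝓣) n (λ k → column S (o + k))
      forcing o {s} {cs} r len marked = along-at⁺ 0 cs λ j lt → trans (sym (at-column j))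
        (cong (at cs) (m<n⇒m%n≡m (subst (j <_) len lt)))
        where
        -- Congruent to -o modulo n; it undoes the rotation by o.
        d : ℕ
        d = o * n′

        G : ℕ → Column
        G k = at cs ((k + d) % n)

        X′ : EdgeSet (P n)
        X′ = fromColumns G

        unwind : ∀ a → (o + (a + d) % n) % n ≡ a % n
        unwind a = trans (cong (_% n) (+-comm o _)) (trans (%-+-% (a + d) o)
          (trans (cong (_% n) (trans (+-assoc a d o) (cong (a +_) (trans (+-comm d o) (sym (*-suc o n′))))))
            ([m+kn]%n≡m%n a o n)))

        mark-at : ∀ i → columnAt S i ⊑ at cs ((toℕ i + d) % n)
        mark-at i = subst (_⊑ at cs ((toℕ i + d) % n))
          (trans (column-cong S (o + (toℕ i + d) % n) (toℕ i) (unwind (toℕ i))) (column-toℕ S i))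
          (along-at⁻ 0 cs marked _ (subst ((toℕ i + d) % n <_) (sym len) (m%n<n (toℕ i + d) n)))

        S⊆X′ : _⊆_ {P n} S X′
        S⊆X′ (uu i) = ⊑-outer {columnAt S i} (mark-at i)
        S⊆X′ (uv i) = ⊑-spoke {columnAt S i} (mark-at i)
        S⊆X′ (vv i) = ⊑-inner {columnAt S i} (mark-at i)

        same : ∀ e → X′ e ≡ X e
        same e = T-ext (proj₂ S-forces X′ (fromRun r len d) S⊆X′ e)

        at-column : ∀ j → at cs (j % n) ≡ C (o + j)
        at-column j = trans (sym (cong (at cs) index)) (trans (sym (column-fromColumns G (o + j))) X′≡X)
          where
          index : ((o + j) % n + d) % n ≡ j % n
          index = trans (%-+-% (o + j) d) (trans (cong (_% n) (trans (cong (_+ d) (+-comm o j))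
            (trans (+-assoc j o d) (cong (j +_) (sym (*-suc o n′)))))) ([m+kn]%n≡m%n j o n))
          j′ = (o + j) mod n
          X′≡X : column X′ (o + j) ≡ column X (o + j)
          X′≡X = cong₂ (λ s (o , i) → ⟨ s , o , i ⟩) (same (uv j′)) (cong₂ _,_ (same (uu j′)) (same (vv j′)))

      bound-from : ∀ ι → certificate ι ≡ true → ∀ i → μ (suc (toℕ i)) ≡ (odd , Start.phase₀ ι) →
        Start.mark ι ⊑ columnAt S i → (∀ k → column S k ⊑ allowed ι (C k)) → n + 12 ≤ 12 * size {P n} S
      bound-from ι cert i phase-eq mark-ok allows =
        subst (λ w → n + 12 ≤ 12 * w) (sym (trans (size-total S) (sym (total-rotate _ n o λ k →
            cong ∣_∣ᶜ (column-cong S (k + n) k ([m+n]%n≡m%n k n))))))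
          (Soundness.bounded⁺ (shift o 𝓣) (λ k → column S (o + k)) n′ n≥11 (forcing o)
            (trans (state-period X pm o) (cong μ (sym (+-identityʳ o))))
            (λ k → marks⊑ (o + k)) ι (table ι) (subst T (sym cert) _)
            (trans (cong μ (+-identityʳ o)) phase-eq)
            (subst (Start.mark ι ⊑_) (sym last) mark-ok)
            (λ k → allows (o + k)))
        where
        -- This rotation makes column i the last one, with index n′.
        o : ℕ
        o = suc (toℕ i)
        last : column S (o + n′) ≡ columnAt S i
        last = trans (cong (column S) (sym (+-suc (toℕ i) n′)))
          (trans (column-cong S (toℕ i + n) (toℕ i) ([m+n]%n≡m%n (toℕ i) n)) (column-toℕ S i))

      -- The matching of all spokes is even and would contain an empty S.
      ¬edgeless : (∀ k → proj₁ (μ k) ≡ odd) → (∀ e → ¬ T (S e)) → ⊥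
      ¬edgeless odds ¬S = case trans (sym (odds n)) (cong proj₁ even-end) of λ ()
        where
        rungs : ∀ k → Run (even , p₀) (replicate k rung) (even , p₀)
        rungs zero    = []
        rungs (suc k) = there (here refl) ∷ rungs k
        unmarked : ∀ k j → Marked (column S) k (replicate j rung)
        unmarked k zero    = _
        unmarked k (suc j) =
          ⊑⁺ (λ s → ⊥-elim (¬S _ s)) (λ s → ⊥-elim (¬S _ s)) (λ s → ⊥-elim (¬S _ s)) , unmarked (suc k) j
        len : length (replicate n rung) ≡ n
        len = length-replicate n
        even-end : μ n ≡ (even , p₀)
        even-end = subst (λ j → μ j ≡ (even , p₀)) len
          (follows-end (shift 0 𝓣) 0 (replicate n rung) (rungs n) (forcing 0 (rungs n) len (unmarked 0 n))
            (subst (2 ≤_) (sym len) (≤-trans (m≤m+n 2 9) n≥11)))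

      module _ (odds : ∀ k → proj₁ (μ k) ≡ odd) where

        before : ∀ (i : Fin n) → (C (toℕ i) , μ (suc (toℕ i))) ∈ₗ steps (odd , proj₂ (μ (toℕ i)))
        before i = subst (λ π → (C (toℕ i) , μ (suc (toℕ i))) ∈ₗ steps (π , proj₂ (μ (toℕ i))))
          (odds (toℕ i)) (Trajectory.step 𝓣 (toℕ i))

        allows-all : ∀ ι → Start.spokes? ι ≡ true → ∀ k → column S k ⊑ allowed ι (C k)
        allows-all ι eq k = ⊑⁺ {column S k} (λ s → ∧⁺ (proj₁ S-forces (uv (k mod n)) s , subst T (sym eq) _))
          (proj₁ S-forces (uu (k mod n))) (proj₁ S-forces (vv (k mod n)))

        allows-spokeless : ∀ ι → ¬ (∃[ i ] T (S (uv i))) → ∀ k → column S k ⊑ allowed ι (C k)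
        allows-spokeless ι ¬spoke k = ⊑⁺ {column S k} (λ s → ⊥-elim (¬spoke (k mod n , s)))
          (proj₁ S-forces (uu (k mod n))) (proj₁ S-forces (vv (k mod n)))

        -- A spoke of S is preferred as the starting edge; in its absence the automata for spokeless
        -- sets apply.
        lower-bound : n + 12 ≤ 12 * size {P n} S
        lower-bound with any? (λ i → T? (S (uv i))) | any? (λ i → T? (S (uu i))) | any? (λ i → T? (S (vv i)))
        ... | yes (i , s) | _ | _ =
          bound-from fromSpoke spoke-certificate i
            (proj₂ (step-spoke odd (proj₂ (μ (toℕ i))) (before i)
              (subst (T ∘ spoke) (sym (column-toℕ X i)) (proj₁ S-forces (uv i) s))))
            (⊑⁺ {rung} {columnAt S i} (λ _ → s) (λ ()) (λ ())) (allows-all fromSpoke refl)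
        ... | no ¬spoke | yes (i , s) | _ =
          [ (λ e → bound-from fromOuter₀ outer₀-certificate i e mark-ok (allows-spokeless fromOuter₀ ¬spoke))
          , (λ e → bound-from fromOuter₁ outer₁-certificate i e mark-ok (allows-spokeless fromOuter₁ ¬spoke)) ]′
          (step-outer (proj₂ (μ (toℕ i))) (before i)
            (subst (T ∘ outer) (sym (column-toℕ X i)) (proj₁ S-forces (uu i) s)))
          where
          mark-ok : ⟨ false , true , false ⟩ ⊑ columnAt S i
          mark-ok = ⊑⁺ {⟨ false , true , false ⟩} {columnAt S i} (λ ()) (λ _ → s) (λ ())
        ... | no ¬spoke | no _ | yes (i , s) =
          [ (λ e → bound-from fromInner₁ inner₁-certificate i e mark-ok (allows-spokeless fromInner₁ ¬spoke))
          , (λ e → bound-from fromInner₃ inner₃-certificate i e mark-ok (allows-spokeless fromInner₃ ¬spoke)) ]′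
          (step-inner (proj₂ (μ (toℕ i))) (before i)
            (subst (T ∘ inner) (sym (column-toℕ X i)) (proj₁ S-forces (vv i) s)))
          where
          mark-ok : ⟨ false , false , true ⟩ ⊑ columnAt S i
          mark-ok = ⊑⁺ {⟨ false , false , true ⟩} {columnAt S i} (λ ()) (λ ()) (λ _ → s)
        ... | no ¬spoke | no ¬outer | no ¬inner = ⊥-elim (¬edgeless odds λ where
          (uv i) s → ¬spoke (i , s)
          (uu i) s → ¬outer (i , s)
          (vv i) s → ¬inner (i , s))

-- Chunks between marked spokes and their rigidity.

∅ : Column
∅ = ⟨ false , false , false ⟩

-- A column of M with its part in S.
Item : Set
Item = Column × Column

data Block : Set where three four : Block

unmarked : Column → Item
unmarked c = c , ∅

word : Block → List Item
word three = map unmarked (slide odd p₀ ∷ rung ∷ slide odd p₃ ∷ [])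
word four  = map unmarked (slide odd p₀ ∷ slide odd p₁ ∷ slide odd p₂ ∷ slide odd p₃ ∷ [])

-- From behind a spoke through the next spoke, which is marked.
chunk : Column → List Block → List Item
chunk t bs = unmarked (slide odd p₃) ∷ concatMap word bs ++ (slide odd p₀ , t) ∷ (rung , rung) ∷ []

-- No walk from s contains the marks.
isolated : State → List Item → Bool
isolated s []            = false
isolated s ((_ , t) ∷ L) = all (λ (c , x) → not (t ⊑ᵇ c) ∨ isolated x L) (steps s)

infix 7 _≡ᶜ_
_≡ᶜ_ : Column → Column → Bool
c ≡ᶜ c′ = c ⊑ᵇ c′ ∧ c′ ⊑ᵇ c

≡ᶜ-sound : ∀ {c c′} → T (c ≡ᶜ c′) → c ≡ c′
≡ᶜ-sound {c} {c′} h = let p , q = ∧⁻ {c ⊑ᵇ c′} h in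
  cong₂ (λ s (o , i) → ⟨ s , o , i ⟩) (T-ext (mk⇔ (⊑-spoke {c} p) (⊑-spoke {c′} q)))
    (cong₂ _,_ (T-ext (mk⇔ (⊑-outer {c} p) (⊑-outer {c′} q))) (T-ext (mk⇔ (⊑-inner {c} p) (⊑-inner {c′} q))))

-- The only walk from s containing the marks is the given one.
rigid : State → List Item → Bool
rigid s ((c° , t) ∷ L) =
  all (λ (c , x) → not (t ⊑ᵇ c) ∨ (if c ≡ᶜ c° then rigid x L else isolated x L)) (steps s)
rigid (odd , p₂) [] = true
rigid _          [] = false

Holds : (ℕ → Column) → ℕ → List Item → Set
Holds m k L = Along (λ k t → t ⊑ m k) k (map proj₂ L)

along-++⁻ : ∀ {R} k cs {ds} → Along R k (cs ++ ds) → Along R k cs × Along R (length cs + k) ds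
along-++⁻ k []       h       = _ , h
along-++⁻ {R} k (c ∷ cs) {ds} (r , h) = let p , q = along-++⁻ (suc k) cs h in
  (r , p) , subst (λ j → Along R j ds) (+-suc (length cs) k) q

along-++⁺ : ∀ {R} k cs {ds} → Along R k cs → Along R (length cs + k) ds → Along R k (cs ++ ds)
along-++⁺ k []       _       h = h
along-++⁺ {R} k (c ∷ cs) {ds} (r , p) q =
  r , along-++⁺ (suc k) cs p (subst (λ j → Along R j ds) (sym (+-suc (length cs) k)) q)

module _ (𝓣 : Trajectory) where
  open Trajectory 𝓣

  holds-++⁻ : ∀ k L {L′} → Holds m k (L ++ L′) → Holds m k L × Holds m (length L + k) L′
  holds-++⁻ k L {L′} h =
    let p , q = along-++⁻ k (map proj₂ L) (subst (Along _ k) (map-++ proj₂ L L′) h) in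
    p , subst (λ j → Holds m (j + k) L′) (length-map proj₂ L) q

  isolated-sound : ∀ k L → T (isolated (μ k) L) → ¬ Holds m k L
  isolated-sound k ((c° , t) ∷ L) iso (t⊑ , h) with ∨⁻ {not (t ⊑ᵇ m k)} (all-∈ iso (step k))
  ... | inj₁ ¬t = not⁻ ¬t t⊑
  ... | inj₂ iso′ = isolated-sound (suc k) L iso′ h

  rigid-sound : ∀ k L → T (rigid (μ k) L) → Holds m k L →
    Follows m k (map proj₁ L) × μ (length L + k) ≡ (odd , p₂)
  rigid-sound k [] r _ with μ k | r
  ... | odd , p₂ | _ = _ , refl
  rigid-sound k ((c° , t) ∷ L) r (t⊑ , h) with ∨⁻ {not (t ⊑ᵇ m k)} (all-∈ {xs = steps (μ k)} r (step k))
  ... | inj₁ ¬t = ⊥-elim (not⁻ ¬t t⊑)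
  ... | inj₂ r′ with m k ≡ᶜ c° in eq
  ...   | true  = let f , e = rigid-sound (suc k) L r′ h in
    (≡ᶜ-sound (subst T (sym eq) _) , f) , trans (cong μ (sym (+-suc (length L) k))) e
  ...   | false = ⊥-elim (isolated-sound (suc k) L r′ h)

  step-outer-p₀ : ∀ s {c π} → (c , π , p₀) ∈ₗ steps s → T (outer c) → π ≡ odd
  step-outer-p₀ (odd  , p₃) (here refl)         _ = refl
  step-outer-p₀ (even , p₀) (there (here refl)) ()
  step-outer-p₀ (even , p₃) (here refl)         ()
  step-outer-p₀ (odd  , p₀) (there (here ()))
  step-outer-p₀ (odd  , p₁) (here ())
  step-outer-p₀ (odd  , p₂) (here ())
  step-outer-p₀ (even , p₁) (here ())
  step-outer-p₀ (even , p₂) (here ())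

  -- In front of a spoke the phase is `p₀`, and the odd `p₀` is the one entered through a column
  -- with an outer edge.
  outer-spoke : ∀ k → T (outer (m k)) → T (spoke (m (suc k))) → μ (2 + k) ≡ (odd , p₂)
  outer-spoke k o s = let π , p = μ (suc k) ; e₀ , e = step-spoke π p (step (suc k)) s in
    trans e (cong (λ π → π , landing π)
      (step-outer-p₀ (μ k) (subst (λ p → (m k , π , p) ∈ₗ steps (μ k)) e₀ (step k)) o))

run-++ : ∀ {s cs x ds y} → Run s cs x → Run x ds y → Run s (cs ++ ds) y
run-++ []      r′ = r′
run-++ (a ∷ r) r′ = a ∷ run-++ r r′

words-run : ∀ bs → Run (odd , p₃) (map proj₁ (concatMap word bs)) (odd , p₃)
words-run []           = []
words-run (three ∷ bs) = here refl ∷ there (here refl) ∷ here refl ∷ words-run bs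
words-run (four  ∷ bs) = here refl ∷ here refl ∷ here refl ∷ here refl ∷ words-run bs

chunk-run : ∀ t bs → Run (odd , p₂) (map proj₁ (chunk t bs)) (odd , p₂)
chunk-run t bs = here refl ∷ subst (λ cs → Run (odd , p₃) cs (odd , p₂)) (sym (map-++ proj₁ (concatMap word bs) _))
  (run-++ (words-run bs) (here refl ∷ there (here refl) ∷ []))

weights : List Item → ℕ
weights []            = 0
weights ((_ , t) ∷ L) = ∣ t ∣ᶜ + weights L

total-weights : ∀ L → total (λ k → ∣ at (map proj₂ L) k ∣ᶜ) (length L) ≡ weights L
total-weights []            = refl
total-weights ((_ , t) ∷ L) = trans
  (total-head (λ k → ∣ at (map proj₂ ((t , t) ∷ L)) k ∣ᶜ) (length L)) (cong (∣ t ∣ᶜ +_) (total-weights L))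

Legal : List Item → Set
Legal = All λ (c , t) → t ⊑ c

at-legal : ∀ {L} → Legal L → ∀ k → at (map proj₂ L) k ⊑ at (map proj₁ L) k
at-legal []      k       = _
at-legal (a ∷ h) zero    = a
at-legal (a ∷ h) (suc k) = at-legal h k

words-legal : ∀ bs → Legal (concatMap word bs)
words-legal []           = []
words-legal (three ∷ bs) = _ ∷ _ ∷ _ ∷ words-legal bs
words-legal (four  ∷ bs) = _ ∷ _ ∷ _ ∷ _ ∷ words-legal bs

-- The outer edge spanning the spoke of the next column; it fixes the parity.
extra : Column
extra = slide odd p₀

-- Both variants are included so that one list of blocks may serve inside a layout as well as at its
-- end.
Tight : List Block → Set
Tight bs = T (rigid (odd , p₂) (chunk ∅ bs)) × T (rigid (odd , p₂) (chunk extra bs))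

layout : List Block → List (List Block) → List Item
layout final []         = chunk extra final
layout final (bs ∷ bss) = chunk ∅ bs ++ layout final bss

layout-run : ∀ final bss → Run (odd , p₂) (map proj₁ (layout final bss)) (odd , p₂)
layout-run final []         = chunk-run extra final
layout-run final (bs ∷ bss) = subst (λ cs → Run (odd , p₂) cs (odd , p₂)) (sym (map-++ proj₁ (chunk ∅ bs) _))
  (run-++ (chunk-run ∅ bs) (layout-run final bss))

layout-legal : ∀ final bss → Legal (layout final bss)
layout-legal final []         = _ ∷ All-++⁺ (words-legal final) (_ ∷ _ ∷ [])
layout-legal final (bs ∷ bss) =
  All-++⁺ {xs = chunk ∅ bs} (_ ∷ All-++⁺ (words-legal bs) (_ ∷ _ ∷ [])) (layout-legal final bss)

module _ (𝓣 : Trajectory) where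
  open Trajectory 𝓣

  -- Every rigid chunk ends in the state behind a spoke, from which the next chunk is rigid in turn.
  layout-rigid : ∀ k final bss → Tight final → All Tight bss → μ k ≡ (odd , p₂) →
    Holds m k (layout final bss) → Follows m k (map proj₁ (layout final bss))
  layout-rigid k final []         tight [] e h =
    proj₁ (rigid-sound 𝓣 k (chunk extra final)
      (subst (λ s → T (rigid s (chunk extra final))) (sym e) (proj₂ tight)) h)
  layout-rigid k final (bs ∷ bss) tight (t ∷ ts) e h =
    let h₁ , h₂ = holds-++⁻ 𝓣 k (chunk ∅ bs) h
        f , e′  = rigid-sound 𝓣 k (chunk ∅ bs) (subst (λ s → T (rigid s (chunk ∅ bs))) (sym e) (proj₁ t)) h₁ in
    subst (Follows m k) (sym (map-++ proj₁ (chunk ∅ bs) (layout final bss)))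
      (along-++⁺ k (map proj₁ (chunk ∅ bs)) f
        (subst (λ j → Follows m (j + k) (map proj₁ (layout final bss))) (sym (length-map proj₁ (chunk ∅ bs)))
          (layout-rigid _ final bss tight ts e′ h₂)))

  layout-last : ∀ k final bss → Holds m k (layout final bss) →
    ∃[ j ] 2 + j ≡ length (layout final bss) + k × T (outer (m j)) × T (spoke (m (suc j)))
  layout-last k final [] (_ , h) =
    let ws       = concatMap word final
        _ , o , s , _ = holds-++⁻ 𝓣 (suc k) ws h in
    length ws + suc k , eq ws ,
    ⊑-outer {extra} {m (length ws + suc k)} o _ , ⊑-spoke {rung} {m (suc (length ws + suc k))} s _
    where
    eq : ∀ ws → 2 + (length ws + suc k) ≡
      length (unmarked (slide odd p₃) ∷ ws ++ (slide odd p₀ , extra) ∷ (rung , rung) ∷ []) + k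
    eq ws = trans (cong (2 +_) (+-suc (length ws) k)) (cong (λ l → suc l + k)
      (trans (+-comm 2 (length ws)) (sym (length-++ ws))))
  layout-last k final (bs ∷ bss) h =
    let j , e , r = layout-last (length (chunk ∅ bs) + k) final bss (proj₂ (holds-++⁻ 𝓣 k (chunk ∅ bs) h)) in
    j , trans e (trans (sym (+-assoc (length (layout final bss)) (length (chunk ∅ bs)) k))
      (cong (_+ k) (trans (+-comm (length (layout final bss)) (length (chunk ∅ bs)))
        (sym (length-++ (chunk ∅ bs) {layout final bss}))))) , r

-- Sums of distances for every n ≥ 11.

record Design (n : ℕ) : Set where
  field
    final : List Block
    bss   : List (List Block)
    final-tight : Tight final
    bss-tight   : All Tight bss
    design-length : length (layout final bss) ≡ n
    design-weight : weights (layout final bss) ≡ ⌈ n / 12 ⌉ + 1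

⌈12+m/12⌉ : ∀ m → ⌈ 12 + m / 12 ⌉ ≡ suc ⌈ m / 12 ⌉
⌈12+m/12⌉ m = +-distrib-/-∣ˡ {12} (m + 11) {12} ∣-refl

-- A chunk is 3 longer than its blocks, so these lists and the empty one give the distances 6, 7, 9,
-- 11, 12 and 3.
pattern 3ᵇ = three ∷ []
pattern 4ᵇ = four ∷ []
pattern 6ᵇ = three ∷ three ∷ []
pattern 8ᵇ = four ∷ four ∷ []
pattern 9ᵇ = three ∷ three ∷ three ∷ []

-- The added chunk has 12 columns and one marked edge, in step with the ceiling.
extend : ∀ {n} → Design n → Design (12 + n)
extend {n} D = record
  { final = final ; bss = 9ᵇ ∷ bss ; final-tight = final-tight ; bss-tight = _ ∷ bss-tight
  ; design-length = cong (12 +_) design-length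
  ; design-weight = trans (cong suc design-weight) (cong (_+ 1) (sym (⌈12+m/12⌉ n))) }
  where open Design D

single : ∀ {n} a → Tight a → length (layout a []) ≡ n → weights (layout a []) ≡ ⌈ n / 12 ⌉ + 1 → Design n
single a t l w = record
  { final = a ; bss = [] ; final-tight = t ; bss-tight = [] ; design-length = l ; design-weight = w }

double : ∀ {n} a b → Tight a → Tight b → length (layout a (b ∷ [])) ≡ n →
  weights (layout a (b ∷ [])) ≡ ⌈ n / 12 ⌉ + 1 → Design n
double a b t t′ l w = record
  { final = a ; bss = b ∷ [] ; final-tight = t ; bss-tight = t′ ∷ [] ; design-length = l ; design-weight = w }

-- The values 11 and 12 are single distances; 13 = 6 + 7 up to 22 = 11 + 11 are sums of two.
base : ∀ (r : Fin 12) → Design (11 + toℕ r)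
base zero                   = single 8ᵇ _ refl refl
base (suc zero)             = single 9ᵇ _ refl refl
base (suc (suc zero))       = double 4ᵇ 3ᵇ _ _ refl refl
base (suc (suc (suc zero))) = double 8ᵇ [] _ _ refl refl
base (suc (suc (suc (suc r)))) = base′ r
  where
  base′ : ∀ (r : Fin 8) → Design (15 + toℕ r)
  base′ zero                         = double 9ᵇ [] _ _ refl refl
  base′ (suc zero)                   = double 6ᵇ 4ᵇ _ _ refl refl
  base′ (suc (suc zero))             = double 8ᵇ 3ᵇ _ _ refl refl
  base′ (suc (suc (suc zero)))       = double 9ᵇ 3ᵇ _ _ refl refl
  base′ (suc (suc (suc (suc r))))    = base″ r
    where
    base″ : ∀ (r : Fin 4) → Design (19 + toℕ r)
    base″ zero                   = double 9ᵇ 4ᵇ _ _ refl refl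
    base″ (suc zero)             = double 8ᵇ 6ᵇ _ _ refl refl
    base″ (suc (suc zero))       = double 9ᵇ 6ᵇ _ _ refl refl
    base″ (suc (suc (suc zero))) = double 8ᵇ 8ᵇ _ _ refl refl

design : ∀ n → 11 ≤ n → Design n
design n n≥11 = subst Design (m+[n∸m]≡n n≥11) (residues ((n ∸ 11) divMod 12))
  where
  periods : ∀ {n} q → Design n → Design (q * 12 + n)
  periods zero    D = D
  periods (suc q) D = extend (periods q D)

  residues : ∀ {k} → DivMod k 12 → Design (11 + k)
  residues (result q r eq) = subst Design
    (trans (+-comm (q * 12) (11 + toℕ r)) (cong (11 +_) (sym eq)))
    (periods q (base r))

-- The upper bound: a matching and a forcing set from a design.

module Upper (n′ : ℕ) (n≥11 : 11 ≤ suc n′) (D : Design (suc n′)) where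
  n : ℕ
  n = suc n′

  open Columns n n≥11
  open Design D

  L : List Item
  L = layout final bss

  -- The summand 0 is the rotation passed to `fromRun`, so that its matching is `M` by definition.
  Mᶜ Sᶜ : ℕ → Column
  Mᶜ k = at (map proj₁ L) ((k + 0) % n)
  Sᶜ k = at (map proj₂ L) ((k + 0) % n)

  M S : EdgeSet (P n)
  M = fromColumns Mᶜ
  S = fromColumns Sᶜ

  M-perfect : PM M
  M-perfect = fromRun (layout-run final bss) (trans (length-map proj₁ L) design-length) 0

  same-index : ∀ k → (k % n + 0) % n ≡ k % n
  same-index k = trans (cong (_% n) (+-identityʳ (k % n))) (m%n%n≡m%n k n)

  M-column : ∀ k → column M k ≡ at (map proj₁ L) (k % n)
  M-column k = trans (column-fromColumns Mᶜ k) (cong (at (map proj₁ L)) (same-index k))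

  S-column : ∀ k → column S k ≡ at (map proj₂ L) (k % n)
  S-column k = trans (column-fromColumns Sᶜ k) (cong (at (map proj₂ L)) (same-index k))

  Sᶜ⊑Mᶜ : ∀ k → Sᶜ k ⊑ Mᶜ k
  Sᶜ⊑Mᶜ k = at-legal (layout-legal final bss) ((k + 0) % n)

  S⊆M : _⊆_ {P n} S M
  S⊆M (uu i) = ⊑-outer {Sᶜ (toℕ i)} (Sᶜ⊑Mᶜ (toℕ i))
  S⊆M (uv i) = ⊑-spoke {Sᶜ (toℕ i)} (Sᶜ⊑Mᶜ (toℕ i))
  S⊆M (vv i) = ⊑-inner {Sᶜ (toℕ i)} (Sᶜ⊑Mᶜ (toℕ i))

  S-size : size {P n} S ≡ ⌈ n / 12 ⌉ + 1
  S-size = begin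
    size {P n} S                                      ≡⟨ size-total S ⟩
    total (λ k → ∣ column S k ∣ᶜ) n                    ≡⟨ total-cong n (λ k lt → cong ∣_∣ᶜ
      (trans (S-column k) (cong (at (map proj₂ L)) (m<n⇒m%n≡m lt)))) ⟩
    total (λ k → ∣ at (map proj₂ L) k ∣ᶜ) n            ≡⟨ cong (total _) design-length ⟨
    total (λ k → ∣ at (map proj₂ L) k ∣ᶜ) (length L)   ≡⟨ total-weights L ⟩
    weights L                                         ≡⟨ design-weight ⟩
    ⌈ n / 12 ⌉ + 1                                    ∎
    where open ≡-Reasoning

  module _ (X : EdgeSet (P n)) (pm : PM X) (S⊆X : _⊆_ {P n} S X) where
    private
      𝓣 = trajectory X pm

    holds : Holds (column X) 0 L
    holds = along-at⁺ 0 (map proj₂ L) λ j lt →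
      subst (_⊑ column X j) (trans (S-column j) (cong (at (map proj₂ L))
          (m<n⇒m%n≡m (subst (j <_) (trans (length-map proj₂ L) design-length) lt))))
        (⊑⁺ {column S j} {column X j} (S⊆X (uv (j mod n))) (S⊆X (uu (j mod n))) (S⊆X (vv (j mod n))))

    last-marks : ∃[ j ] 2 + j ≡ length L + 0 × T (outer (column X j)) × T (spoke (column X (suc j)))
    last-marks = layout-last 𝓣 0 final bss holds

    -- The extra edge and the last spoke end the layout and fix the state at n, which is the state
    -- at 0.
    starts-odd : state X pm 0 ≡ (odd , p₂)
    starts-odd = let j , e , o , s = last-marks in
      trans (sym (state-period X pm 0))
        (trans (cong (state X pm) (sym (trans e (trans (+-identityʳ (length L)) design-length))))
          (outer-spoke 𝓣 j o s))

    follows : ∀ k → k < n → column X k ≡ column M k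
    follows k lt = trans
      (along-at⁻ 0 (map proj₁ L) (layout-rigid 𝓣 0 final bss final-tight bss-tight starts-odd holds) k
        (subst (k <_) (sym (trans (length-map proj₁ L) design-length)) lt))
      (sym (trans (M-column k) (cong (at (map proj₁ L)) (m<n⇒m%n≡m lt))))

    column-same : ∀ i → columnAt X i ≡ columnAt M i
    column-same i = trans (sym (column-toℕ X i)) (trans (follows (toℕ i) (toℕ<n i)) (column-toℕ M i))

    edge-same : ∀ e → X e ≡ M e
    edge-same (uu i) = cong outer (column-same i)
    edge-same (uv i) = cong spoke (column-same i)
    edge-same (vv i) = cong inner (column-same i)

  S-forces : IsForcingSet {P n} M S
  S-forces = S⊆M , λ X pm S⊆X e →
    mk⇔ (subst T (edge-same X pm S⊆X e)) (subst T (sym (edge-same X pm S⊆X e)))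

  M∈𝓜₂ : 𝓜₂ n M
  M∈𝓜₂ = M-perfect , inj₁ ((suc j mod n , s) , gaps)
    where
    𝓣 = trajectory M M-perfect
    C = column M
    j = proj₁ (last-marks M M-perfect S⊆M)
    s : T (spoke (C (suc j)))
    s = proj₂ (proj₂ (proj₂ (last-marks M M-perfect S⊆M)))

    odds : ∀ k → proj₁ (state M M-perfect (k + 0)) ≡ odd
    odds k = stays-odd 𝓣 0 k (cong proj₁ (starts-odd M M-perfect S⊆M))

    gaps : SpokeGaps≡2mod4 n M
    gaps i g _ i∈ end∈ between = gap-mod 𝓣 (suc (toℕ i)) g landed
      (λ j lt s → between j lt (subst (T ∘ spoke) (column-gap M i j) s))
      (subst (T ∘ spoke) (sym (column-gap M i g)) end∈)
      where
      landed : state M M-perfect (suc (toℕ i)) ≡ (odd , p₂)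
      landed = proj₂ (step-spoke odd _
        (subst
          (λ π → (C (toℕ i) , state M M-perfect (suc (toℕ i))) ∈ₗ steps (π , proj₂ (state M M-perfect (toℕ i))))
          (trans (cong (proj₁ ∘ state M M-perfect) (sym (+-identityʳ (toℕ i)))) (odds (toℕ i)))
          (Trajectory.step 𝓣 (toℕ i)))
        (subst (T ∘ spoke) (sym (column-toℕ M i)) i∈))

-- The minimum over all matchings.

forcing-size : ∀ n .{{_ : NonZero n}} → 11 ≤ n → ∀ X → 𝓜₂ n X → ∀ S → IsForcingSet {P n} X S →
  ⌈ n / 12 ⌉ + 1 ≤ size {P n} S
forcing-size n@(suc n′) n≥11 X X∈ S S-forces = subst (_≤ size {P n} S) (+-comm 1 ⌈ n / 12 ⌉)
  -- With s the size of S, n + 12 ≤ 12 s means n + 11 < 12 s, so the floor of (n + 11) / 12, which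
  -- is the ceiling of n / 12, is less than s.
  (m<n*o⇒m/o<n {n + 11} {size {P n} S} {12} (begin
    suc (n + 11)         ≡⟨ +-suc n 11 ⟨
    n + 12               ≤⟨ Lower.lower-bound n′ n≥11 X (proj₁ X∈) S S-forces
      (Lower.𝓜₂⇒odd n′ n≥11 X (proj₁ X∈) X∈) ⟩
    12 * size {P n} S    ≡⟨ *-comm 12 (size {P n} S) ⟩
    size {P n} S * 12    ∎))
  where open ≤-Reasoning

theorem4p2 : ∀ (n : ℕ) .{{_ : NonZero n}} → n ≥ 11 →
    IsMinimum (λ m → ∃[ M ] 𝓜₂ n M × IsForcingNumber (P n) M m) (⌈ n / 12 ⌉ + 1)
theorem4p2 n@(suc n′) n≥11 =
  -- The lower bound serves twice: it settles the forcing number of the constructed `M`, and it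
  -- bounds that of every competitor.
  (M , M∈𝓜₂ , (S , S-forces , S-size) , λ { k (S′ , S′-forces , refl) → forcing-size n n≥11 M M∈𝓜₂ S′ S′-forces }) ,
  λ { k (X , X∈ , (S′ , S′-forces , refl) , _) → forcing-size n n≥11 X X∈ S′ S′-forces }
  where open Upper n′ n≥11 (design n n≥11) using (M; M∈𝓜₂; S; S-forces; S-size)
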